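{- For any odd prime power $q$, there exist the following pencil arcs in $\Pi_2(q^2)$: (i) a $(q^2+q)$-parc $\mathcal{K}$ in which there are two lines of the pencil containing $q$ points of $\mathcal{K}$ and $(q-1)/2$ lines of the pencil containing $2q$ points of $\mathcal{K}$; (ii) a regular $((q+1)/2,\,2q)$-parc; (iii) a regular $(q,q)$-parc.
   Context: $\Pi_2(n)$ denotes the desarguesian projective plane over $GF(n)$. A pencil in $\Pi_2(n)$ is the set of all $n+1$ lines $\Psi_0,\ldots,\Psi_n$ through some common point. A $k$-parc (pencil arc) in $\Pi_2(n)$ with pencil $\Psi_0,\ldots,\Psi_n$ is a set $\mathcal{K}$ of $k$ points such that: (a) each $\mathcal{K}\cap\Psi_i$ is an $h_i$-arc in the projective line $\Psi_i$, where $h_i=|\mathcal{K}\cap\Psi_i|$ (i.e. any two of its points are independent, which is automatic); (b) $\mathcal{K}\cap\Psi_i\cap\Psi_j=\emptyset$ for $i\neq j$; (c) any three points of $\mathcal{K}$ not contained in any single $\Psi_i$ are linearly independent (non-collinear). A regular $(m,h)$-parc is a pencil arc for which, for a suitable labelling of the lines of the pencil, $h_0=h_1=\cdots=h_{m-1}=h$ and $h_m=\cdots=h_n=0$. -}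

module Defs where

open import Level using (Level; _⊔_) renaming (suc to lsuc)
open import Algebra.Apartness.Bundles using (HeytingCommutativeRing; HeytingField)
open import Algebra.Bundles using (CommutativeRing)
open import Data.Fin.Base using (Fin; toℕ)
open import Data.Fin.Permutation using (Permutation′; _⟨$⟩ʳ_)
open import Data.Nat.Base as ℕ using (ℕ; suc; NonZero)
open import Data.Nat.Primality using (Prime)
open import Data.Product.Base using (Σ; ∃; ∃-syntax; _×_; _,_; proj₁)
open import Data.Vec.Functional using (Vector; []; _∷_)
open import Function.Bundles using (Inverse)
open import Relation.Binary.Bundles using (Setoid)
open import Relation.Binary.Definitions using (_Respects_)
open import Relation.Binary.PropositionalEquality as ≡ using (_≡_)
open import Relation.Nullary using (¬_)
open import Relation.Unary using (Pred; _∈_; _∩_)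
import Algebra.Properties.Semiring.Sum as Sum
import Algebra.Properties.Group as GroupProperties
import Relation.Binary.Construct.On as On
import Relation.Binary.Reasoning.Setoid as SetoidReasoning

PrimePower : Pred ℕ _
PrimePower q = ∃[ p ] ∃[ k ] (Prime p × NonZero k × q ≡ p ℕ.^ k)

-- The subset P of the setoid S has exactly k elements, counted up to the
-- equality of S: membership proofs are not distinguished.
HasSize : ∀ {a ℓ p} (S : Setoid a ℓ) → Pred (Setoid.Carrier S) p → ℕ →
          Set (a ⊔ ℓ ⊔ p)
HasSize S P k = Inverse (On.setoid S (proj₁ {B = P})) (≡.setoid (Fin k))

-- Any model of GF(n), i.e. any field with exactly n elements.  Finiteness makes
-- _≈_ decidable, so that x # y is the same as ¬ (x ≈ y), and a Heyting field is
-- a field in the usual sense; 1# # 0# follows from invertible⇒#.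
record GF (c ℓ₁ ℓ₂ : Level) (n : ℕ) : Set (lsuc (c ⊔ ℓ₁ ⊔ ℓ₂)) where
  field
    heytingField : HeytingField c ℓ₁ ℓ₂

  open HeytingField heytingField public
    using (_#_; #⇒invertible; invertible⇒#; tight; heytingCommutativeRing)
  open HeytingCommutativeRing heytingCommutativeRing public
    using (commutativeRing)
  open CommutativeRing commutativeRing public

  field
    enumeration : Inverse setoid (≡.setoid (Fin n))

-- The desarguesian projective plane over GF(n).
module Π₂ {c ℓ₁ ℓ₂ : Level} {n : ℕ} (F : GF c ℓ₁ ℓ₂ n) where

  open GF F
  open Sum semiring using (sum)

  V : Set c
  V = Vector Carrier 3

  Homogeneous : Set (c ⊔ ℓ₂)
  Homogeneous = Σ V λ v → ∃[ i ] v i # 0#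

  coords : Homogeneous → V
  coords = proj₁

  _∼_ : Homogeneous → Homogeneous → Set (c ⊔ ℓ₁ ⊔ ℓ₂)
  u ∼ v = ∃[ a ] (a # 0# × (∀ i → coords u i ≈ a * coords v i))

  private
    open SetoidReasoning setoid

    x-0≈x : ∀ x → x - 0# ≈ x
    x-0≈x x = trans (+-congˡ (GroupProperties.ε⁻¹≈ε +-group)) (+-identityʳ x)

    unit⇒#0 : ∀ {x y} → y * x ≈ 1# → x # 0#
    unit⇒#0 {x} {y} yx≈1 = invertible⇒#
      (y , trans (*-congˡ (x-0≈x x)) yx≈1
         , trans (*-congʳ (x-0≈x x)) (trans (*-comm x y) yx≈1))

    #0⇒unit : ∀ {x} → x # 0# → ∃[ y ] y * x ≈ 1#
    #0⇒unit {x} x#0 with #⇒invertible x#0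
    ... | y , yx≈1 , _ = y , trans (*-congˡ (sym (x-0≈x x))) yx≈1

    ∼-refl : ∀ {u} → u ∼ u
    ∼-refl = 1# , unit⇒#0 (*-identityˡ 1#) , λ i → sym (*-identityˡ _)

    ∼-sym : ∀ {u v} → u ∼ v → v ∼ u
    ∼-sym {u} {v} (a , a#0 , eq) with #0⇒unit a#0
    ... | b , ba≈1 = b , unit⇒#0 (trans (*-comm a b) ba≈1) , λ i → begin
      coords v i            ≈⟨ *-identityˡ _ ⟨
      1# * coords v i       ≈⟨ *-congʳ ba≈1 ⟨
      (b * a) * coords v i  ≈⟨ *-assoc _ _ _ ⟩
      b * (a * coords v i)  ≈⟨ *-congˡ (eq i) ⟨
      b * coords u i        ∎

    ∼-trans : ∀ {u v w} → u ∼ v → v ∼ w → u ∼ w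
    ∼-trans {u} {v} {w} (a , a#0 , eq) (b , b#0 , eq′)
      with #0⇒unit a#0 | #0⇒unit b#0
    ... | a⁻¹ , p | b⁻¹ , p′ = a * b , unit⇒#0 unit , λ i → begin
      coords u i            ≈⟨ eq i ⟩
      a * coords v i        ≈⟨ *-congˡ (eq′ i) ⟩
      a * (b * coords w i)  ≈⟨ *-assoc _ _ _ ⟨
      (a * b) * coords w i  ∎
      where
      unit : (b⁻¹ * a⁻¹) * (a * b) ≈ 1#
      unit = begin
        (b⁻¹ * a⁻¹) * (a * b)  ≈⟨ *-assoc _ _ _ ⟩
        b⁻¹ * (a⁻¹ * (a * b))  ≈⟨ *-congˡ (*-assoc _ _ _) ⟨
        b⁻¹ * ((a⁻¹ * a) * b)  ≈⟨ *-congˡ (*-congʳ p) ⟩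
        b⁻¹ * (1# * b)         ≈⟨ *-congˡ (*-identityˡ b) ⟩
        b⁻¹ * b                ≈⟨ p′ ⟩
        1#                     ∎

  homogeneousSetoid : Setoid (c ⊔ ℓ₂) (c ⊔ ℓ₁ ⊔ ℓ₂)
  homogeneousSetoid = record
    { Carrier       = Homogeneous
    ; _≈_           = _∼_
    ; isEquivalence = record
      { refl  = λ {u} → ∼-refl {u}
      ; sym   = λ {u} {v} → ∼-sym {u} {v}
      ; trans = λ {u} {v} {w} → ∼-trans {u} {v} {w}
      }
    }

  -- A line is given by the coefficients of its equation.
  Point Line : Set (c ⊔ ℓ₂)
  Point = Homogeneous
  Line  = Homogeneous

  pointsOn : Line → Pred Point ℓ₁
  pointsOn l x = sum (λ i → coords l i * coords x i) ≈ 0#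

  LinearlyIndependent : ∀ {m} → Vector V m → Set (c ⊔ ℓ₁)
  LinearlyIndependent {m} v =
    ∀ (a : Vector Carrier m) →
    (∀ i → sum (λ j → a j * v j i) ≈ 0#) → ∀ j → a j ≈ 0#

  PointSet : Set (lsuc (c ⊔ ℓ₁ ⊔ ℓ₂))
  PointSet = Pred Point (c ⊔ ℓ₁ ⊔ ℓ₂)

  -- A k-arc in a projective line.
  record IsLineArc {s} (k : ℕ) (A : Pred Point s) : Set (c ⊔ ℓ₁ ⊔ ℓ₂ ⊔ s) where
    field
      size : HasSize homogeneousSetoid A k
      independent : ∀ {x y} → x ∈ A → y ∈ A → ¬ x ∼ y →
                    LinearlyIndependent (coords x ∷ coords y ∷ [])

  record Pencil : Set (c ⊔ ℓ₁ ⊔ ℓ₂) where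
    field
      vertex     : Point
      line       : Fin (suc n) → Line
      concurrent : ∀ i → vertex ∈ pointsOn (line i)
      distinct   : ∀ {i j} → line i ∼ line j → i ≡ j
      complete   : ∀ l → vertex ∈ pointsOn l → ∃[ i ] l ∼ line i

  record IsParc (k : ℕ) (Ψ : Pencil) (K : PointSet) :
                Set (c ⊔ ℓ₁ ⊔ ℓ₂) where
    open Pencil Ψ
    field
      respects : K Respects _∼_
      size     : HasSize homogeneousSetoid K k
      h        : Fin (suc n) → ℕ
      lineArc  : ∀ i → IsLineArc (h i) (K ∩ pointsOn (line i))
      disjoint : ∀ {i j} → ¬ i ≡ j → ∀ x →
                 ¬ x ∈ (K ∩ pointsOn (line i) ∩ pointsOn (line j))
      independent : ∀ {x y z} → x ∈ K → y ∈ K → z ∈ K →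
        ¬ x ∼ y → ¬ x ∼ z → ¬ y ∼ z →
        ¬ (∃[ i ] (x ∈ pointsOn (line i) × y ∈ pointsOn (line i)
                                         × z ∈ pointsOn (line i))) →
        LinearlyIndependent (coords x ∷ coords y ∷ coords z ∷ [])

    -- Exactly r lines of the pencil contain exactly s points of K.
    LinesWith : (r s : ℕ) → Set
    LinesWith r s = HasSize (≡.setoid (Fin (suc n))) (λ i → h i ≡ s) r

  record IsRegularParc (m s : ℕ) (Ψ : Pencil) (K : PointSet) :
                       Set (c ⊔ ℓ₁ ⊔ ℓ₂) where
    field
      {k}    : ℕ
      isParc : IsParc k Ψ K

    open IsParc isParc using (h)

    field
      m≤n+1     : m ℕ.≤ suc n
      labelling : Permutation′ (suc n)
      initial   : ∀ i → toℕ i ℕ.< m → h (labelling ⟨$⟩ʳ i) ≡ s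
      final     : ∀ i → m ℕ.≤ toℕ i → h (labelling ⟨$⟩ʳ i) ≡ 0

{-# OPTIONS --safe #-}
module Submission where

-- Let F be the field of order q².  It has the involution σ x = x^q; its fixed
-- elements form the subfield of order q, and Tr y = y + σ y and N y = y σ y
-- are the trace and the norm to it.  Take the lines through (0 : 0 : 1) as the
-- pencil.  The pencil arcs are the sets of points (z : x : y) with
--
--   (i)    z, x fixed and (Tr y)² = z x, where (z , x) is (0 , 1) or (1 , x);
--   (ii)   z = 1, N s = 1 and s² = x, where s = y + x σ y;
--   (iii)  z = 1, x fixed and Tr y = x².
--
-- Geometrically, a four-dimensional subspace of F³ over the fixed field is a
-- projective space PG(3,q) in which (0 : 0 : 1) is represented by a whole line
-- ℓ.  Each of the three sets comes from a cone over a conic of PG(2,q), with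
-- its vertex on ℓ, and ℓ meets the plane of the conic in a point that is
-- external to the conic, internal to it, or on it.  A line of the pencil thus
-- has q points for each point of the conic on the corresponding line through
-- that point, and there are two tangents and (q-1)/2 secants, (q+1)/2 secants,
-- or q secants with one further point each.
--
-- Independence.  If two of three points lie on one line of the pencil and the
-- third does not, their determinant is visibly nonzero.  For three different
-- lines, suppose that the determinant vanishes.  Combined with its conjugate it
-- becomes the determinant of the three points of the conic (Tr-det in (i) and
-- (iii), InternalConic.noncollinear in (ii)), which is a product of nonzero
-- factors (conic-noncollinear in (i) and (ii), a Vandermonde determinant in
-- (iii)).
--
-- Counting.  X^q - X and the polynomials X^q + X - s have at most q roots, and
-- the trace spreads the q² elements of F over the fixed field; so there are
-- exactly q fixed elements, and the trace takes each of them as value exactly q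
-- times (#fixed≡q, Tr-fibre).  Likewise, the norm takes the value 1 exactly
-- q + 1 times (#unit≡1+q).  The line of direction x contains q points for each
-- square root s of x that is fixed, in (i), or of norm 1, in (ii).  As s and -s
-- differ in odd characteristic, a nonzero x has no or two such roots; adding up
-- their numbers over all x counts the lines with 2q points.  In (iii), the line
-- contains q points if x is fixed and none otherwise.
--
-- That σ is additive is the binomial theorem in characteristic p, and that it
-- is an involution is Fermat's theorem x^(q²) = x.


open import Level using (Level)
open import Algebra.Bundles using (CommutativeRing)
open import Data.Bool.Base using (if_then_else_)
open import Data.Fin.Base as Fin using (Fin; zero; suc; toℕ; fromℕ; inject₁; punchIn)
open import Data.Fin.Patterns using (0F; 1F; 2F)
open import Data.Fin.Permutation as Perm using (Permutation′; _⟨$⟩ʳ_)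
open import Data.Fin.Properties as Fin using (_≟_)
open import Data.Fin.Relation.Unary.Top using (view; ‵fromℕ; ‵inject₁)
open import Data.Integer.Base as ℤ using (ℤ; +_; -[1+_]; _⊖_)
import Data.Integer.Properties as ℤ
open import Data.Maybe.Base using (Maybe; just; nothing)
open import Data.Nat.Base as ℕ using (ℕ; zero; suc; NonZero)
open import Data.Nat.Combinatorics using (_C_; nCn≡1; nCk≡nC[n∸k]; k![n∸k]!∣n!)
open import Data.Nat.Combinatorics.Specification using (nCk≡n!/k![n-k]!)
open import Data.Nat.Divisibility as ∣ using (_∣_; divides)
import Data.Nat.DivMod as ℕ
open import Data.Nat.Primality as Prime using (Prime; euclidsLemma)
import Data.Nat.Properties as ℕ
open import Data.Product using (Σ; Σ-syntax; ∃-syntax; _×_; _,_; proj₁; proj₂)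
open import Data.Sum.Base using (_⊎_; inj₁; inj₂)
open import Data.Sum.Function.Propositional using (_⊎-↔_)
open import Function.Base using (_∘_; _$_)
open import Function.Bundles using (_↔_; Inverse; mk↔ₛ′)
open import Function.Construct.Composition using (_↔-∘_)
open import Function.Properties.Inverse using (↔-refl)
open import Relation.Binary.Bundles using (Setoid)
open import Relation.Binary.Definitions using (_Respects_)
open import Relation.Binary.PropositionalEquality as ≡ using (_≡_)
open import Relation.Nullary using (¬_; Dec; yes; no; does; contradiction)
open import Relation.Nullary.Decidable using (_×-dec_; map′; dec-true; dec-false)
open import Relation.Unary using (Pred; Decidable; _∈_; _∩_)
import Algebra.Properties.Semiring.Sum ℕ.+-*-semiring as ∑ℕ
import Relation.Binary.Reasoning.Setoid as SetoidReasoning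

open ∑ℕ using (sum; sum-syntax)
open import Defs

private module ≡R = ≡.≡-Reasoning

-- Counting in finite sets

module Counting where
  open import Data.Nat.Base using (_+_; _*_; _≤_; _<_; z≤n; s≤s)

  private variable
    a b p r ℓ : Level
    A : Set a
    B : Set b
    m n : ℕ

  -- The Iverson bracket of a decided proposition.
  [_] : Dec A → ℕ
  [ d ] = if does d then 1 else 0

  []-true : (d : Dec A) → A → [ d ] ≡ 1
  []-true d x rewrite dec-true d x = ≡.refl

  []-false : (d : Dec A) → ¬ A → [ d ] ≡ 0
  []-false d ¬x rewrite dec-false d ¬x = ≡.refl

  []-cong : (d : Dec A) (e : Dec B) → (A → B) → (B → A) → [ d ] ≡ [ e ]
  []-cong (yes x) e f g = ≡.sym ([]-true e (f x))
  []-cong (no ¬x) e f g = ≡.sym ([]-false e (¬x ∘ g))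

  []-× : (d : Dec A) (e : Dec B) → [ d ×-dec e ] ≡ [ d ] * [ e ]
  []-× (yes _) (yes _) = ≡.refl
  []-× (yes _) (no _)  = ≡.refl
  []-× (no _)  e       = ≡.refl

  -- Fin [ d ] is a proof-irrelevant copy of the proposition decided by d, which
  -- makes finite sets cut out by decidable predicates enumerable.
  []-elim : (d : Dec A) → Fin [ d ] → A
  []-elim (yes x) _ = x

  []-intro : (d : Dec A) → A → Fin [ d ]
  []-intro d x = ≡.subst Fin (≡.sym ([]-true d x)) zero

  []-unique : (d : Dec A) (i j : Fin [ d ]) → i ≡ j
  []-unique (yes _) zero zero = ≡.refl

  -- The number of elements of Fin n that satisfy a decidable predicate.
  count : {P : Pred (Fin n) p} → Decidable P → ℕ
  count P? = sum (λ i → [ P? i ])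

  sum-mono : {f g : Fin n → ℕ} → (∀ i → f i ≤ g i) → sum f ≤ sum g
  sum-mono {n = zero}  f≤g = z≤n
  sum-mono {n = suc n} f≤g = ℕ.+-mono-≤ (f≤g zero) (sum-mono (f≤g ∘ suc))

  -- A termwise inequality whose sums agree is a termwise equality.
  sum-tight : {f g : Fin n → ℕ} → (∀ i → f i ≤ g i) → sum g ≤ sum f → ∀ i → f i ≡ g i
  sum-tight {f = f} {g} f≤g ∑g≤∑f zero =
    ℕ.≤-antisym (f≤g zero) (ℕ.+-cancelʳ-≤ _ _ _
        (ℕ.≤-trans ∑g≤∑f (ℕ.+-monoʳ-≤ (f zero) (sum-mono (f≤g ∘ suc)))))
  sum-tight {f = f} {g} f≤g ∑g≤∑f (suc i) = sum-tight (f≤g ∘ suc)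
    (ℕ.+-cancelˡ-≤ (g zero) _ _ (ℕ.≤-trans ∑g≤∑f (ℕ.+-monoˡ-≤ _ (f≤g zero)))) i

  sum-const : ∀ n k → sum {n} (λ _ → k) ≡ n * k
  sum-const zero    k = ≡.refl
  sum-const (suc n) k = ≡.cong (_+_ k) (sum-const n k)

  sum-zero : {f : Fin n → ℕ} → (∀ i → f i ≡ 0) → sum f ≡ 0
  sum-zero {n} f≡0 = ≡.trans (∑ℕ.sum-cong-≗ f≡0) (∑ℕ.sum-replicate-zero n)

  sum-δ : (i : Fin n) (f : Fin n → ℕ) → sum (λ j → [ i ≟ j ] * f j) ≡ f i
  sum-δ {suc n} zero    f = ≡.trans (≡.cong₂ _+_ (ℕ.+-identityʳ (f zero))
      (sum-zero {n} λ _ → ≡.refl)) (ℕ.+-identityʳ (f zero))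
  sum-δ (suc i) f = sum-δ i (f ∘ suc)

  count-≡ : (i : Fin n) → count (i ≟_) ≡ 1
  count-≡ i = ≡.trans (∑ℕ.sum-cong-≗ λ j → ≡.sym (ℕ.*-identityʳ [ i ≟ j ])) (sum-δ i (λ _ → 1))

  count-cong : {P : Pred (Fin n) p} {Q : Pred (Fin n) r} (P? : Decidable P) (Q? : Decidable Q) →
               (∀ {i} → P i → Q i) → (∀ {i} → Q i → P i) → count P? ≡ count Q?
  count-cong P? Q? f g = ∑ℕ.sum-cong-≗ λ i → []-cong (P? i) (Q? i) f g

  count≤n : {P : Pred (Fin n) p} (P? : Decidable P) → count P? ≤ n
  count≤n {zero}  P? = z≤n
  count≤n {suc n} P? with P? zero
  ... | yes _ = s≤s (count≤n (P? ∘ suc))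
  ... | no  _ = ℕ.m≤n⇒m≤1+n (count≤n (P? ∘ suc))

  count-⊎ : {P : Pred (Fin n) p} {Q R : Pred (Fin n) r}
            (P? : Decidable P) (Q? : Decidable Q) (R? : Decidable R) →
            (∀ {i} → P i → Q i ⊎ R i) → count P? ≤ count Q? + count R?
  count-⊎ P? Q? R? P⊆Q∪R = ℕ.≤-trans (sum-mono bound)
    (ℕ.≤-reflexive (∑ℕ.∑-distrib-+ (λ i → [ Q? i ]) (λ i → [ R? i ])))
    where
    bound : ∀ i → [ P? i ] ≤ [ Q? i ] + [ R? i ]
    bound i with P? i
    ... | no  _ = z≤n
    ... | yes Pi with P⊆Q∪R Pi
    ...   | inj₁ Qi = ℕ.≤-trans (ℕ.≤-reflexive (≡.sym ([]-true (Q? i) Qi))) (ℕ.m≤m+n _ _)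
    ...   | inj₂ Ri = ℕ.≤-trans (ℕ.≤-reflexive (≡.sym ([]-true (R? i) Ri))) (ℕ.m≤n+m _ _)

  sum-fibres : (φ : Fin m → Fin n) → ∑[ j < n ] count (λ i → φ i ≟ j) ≡ m
  sum-fibres {m} {n} φ = begin
    ∑[ j < n ] (∑[ i < m ] [ φ i ≟ j ])  ≡⟨ ∑ℕ.∑-comm (λ j i → [ φ i ≟ j ]) ⟩
    ∑[ i < m ] count (φ i ≟_)            ≡⟨ ∑ℕ.sum-cong-≗ (count-≡ ∘ φ) ⟩
    ∑[ i < m ] 1                         ≡⟨ sum-const m 1 ⟩
    m * 1                                ≡⟨ ℕ.*-identityʳ m ⟩
    m                                    ∎
    where open ≡.≡-Reasoning

  -- To count a subset up to the equality of a setoid it is enough to enumerate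
  -- representatives: pairwise inequivalent elements of P that meet every class
  -- of P.
  module _ {S : Setoid a ℓ} {P : Pred (Setoid.Carrier S) p} {k : ℕ} where
    open Setoid S

    hasSize : Fin k ↔ B → (f : B → Carrier) → (∀ b → P (f b)) →
              (∀ {b b′} → f b ≈ f b′ → b ≡ b′) → (∀ x → P x → ∃[ b ] x ≈ f b) →
              HasSize S P k
    hasSize Fin↔B f Pf inj surj = record
      { to        = λ (x , Px) → from (proj₁ (surj x Px))
      ; from      = λ i → f (to i) , Pf (to i)
      ; to-cong   = λ { {x , Px} {y , Py} x≈y → ≡.cong from $
          inj (trans (sym (proj₂ (surj x Px))) (trans x≈y (proj₂ (surj y Py)))) }
      ; from-cong = λ i≡j → reflexive (≡.cong (f ∘ to) i≡j)
      ; inverse   = (λ { {i} {x , Px} x≈fi → ≡.trans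
                       (≡.cong from (inj (trans (sym (proj₂ (surj x Px))) x≈fi)))
                       (strictlyInverseʳ i) })
                  , (λ { {x , Px} {i} ≡.refl → trans
                       (reflexive (≡.cong f (strictlyInverseˡ _)))
                       (sym (proj₂ (surj x Px))) })
      }
      where open Inverse Fin↔B

  -- Fin turns a finite sum of cardinals into the corresponding disjoint union.
  sum-↔ : (c : Fin m → ℕ) → Fin (sum c) ↔ Σ (Fin m) (Fin ∘ c)
  sum-↔ {zero}  c = mk↔ₛ′ (λ ()) (λ ()) (λ ()) (λ ())
  sum-↔ {suc m} c = split ↔-∘ ((↔-refl ⊎-↔ sum-↔ (c ∘ suc)) ↔-∘ Fin.+↔⊎)
    where
    split : (Fin (c zero) ⊎ Σ (Fin m) (Fin ∘ c ∘ suc)) ↔ Σ (Fin (suc m)) (Fin ∘ c)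
    split = mk↔ₛ′
      (λ { (inj₁ x) → zero , x ; (inj₂ (i , x)) → suc i , x })
      (λ { (zero , x) → inj₁ x ; (suc i , x) → inj₂ (i , x) })
      (λ { (zero , x) → ≡.refl ; (suc i , x) → ≡.refl })
      (λ { (inj₁ x) → ≡.refl ; (inj₂ (i , x)) → ≡.refl })

  count-hasSize : {P : Pred (Fin n) p} (P? : Decidable P) →
      HasSize (≡.setoid (Fin n)) P (count P?)
  count-hasSize P? = hasSize (sum-↔ (λ i → [ P? i ])) proj₁
    (λ (i , x) → []-elim (P? i) x)
    (λ { {i , x} {.i , y} ≡.refl → ≡.cong (i ,_) ([]-unique (P? i) x y) })
    (λ i Pi → (i , []-intro (P? i) Pi) , ≡.refl)

  punchIn-last : (i : Fin n) → punchIn (fromℕ n) i ≡ inject₁ i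
  punchIn-last zero    = ≡.refl
  punchIn-last (suc i) = ≡.cong suc (punchIn-last i)

  -- Some relabelling of Fin n puts the elements that satisfy P first.
  sortingPermutation : {P : Pred (Fin n) p} (P? : Decidable P) → Σ[ π ∈ Permutation′ n ]
    (∀ i → toℕ i < count P? → P (π ⟨$⟩ʳ i)) × (∀ i → count P? ≤ toℕ i → ¬ P (π ⟨$⟩ʳ i))
  sortingPermutation {zero} P? = Perm.id , (λ ()) , (λ ())
  sortingPermutation {suc n} {P = P} P? with P? zero | sortingPermutation (P? ∘ suc)
  ... | yes P0 | π , init , final = Perm.lift₀ π
    , (λ { zero _ → P0 ; (suc i) (s≤s i<) → init i i< })
    , (λ { (suc i) (s≤s ≤i) → final i ≤i })
  -- An element that fails P is moved to the last position.
  ... | no ¬P0 | π , init , final = ρ , init′ , final′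
    where
    ρ : Permutation′ (suc n)
    ρ = Perm.insert (fromℕ n) zero π

    ρ-last : ρ ⟨$⟩ʳ fromℕ n ≡ zero
    ρ-last with fromℕ n ≟ fromℕ n
    ... | yes _ = ≡.refl
    ... | no ¬p = contradiction ≡.refl ¬p

    ρ-inject₁ : ∀ i → ρ ⟨$⟩ʳ inject₁ i ≡ suc (π ⟨$⟩ʳ i)
    ρ-inject₁ i = ≡.trans (≡.cong (ρ ⟨$⟩ʳ_) (≡.sym (punchIn-last i)))
        (Perm.insert-punchIn (fromℕ n) zero π i)

    init′ : ∀ i → toℕ i < count (P? ∘ suc) → P (ρ ⟨$⟩ʳ i)
    init′ i i< with view i
    ... | ‵fromℕ     = contradiction (count≤n (P? ∘ suc))
      (ℕ.<⇒≱ (≡.subst (_< count (P? ∘ suc)) (Fin.toℕ-fromℕ n) i<))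
    ... | ‵inject₁ j = ≡.subst P (≡.sym (ρ-inject₁ j))
        (init j (≡.subst (_< _) (Fin.toℕ-inject₁ j) i<))

    final′ : ∀ i → count (P? ∘ suc) ≤ toℕ i → ¬ P (ρ ⟨$⟩ʳ i)
    final′ i ≤i Pρi with view i
    ... | ‵fromℕ     = ¬P0 (≡.subst P ρ-last Pρi)
    ... | ‵inject₁ j = final j (≡.subst (_ ≤_) (Fin.toℕ-inject₁ j) ≤i)
        (≡.subst P (ρ-inject₁ j) Pρi)

  sum-sum-↔ : ∀ {m n} (f : Fin m → Fin n → ℕ) →
    Fin (sum (λ i → sum (f i))) ↔ Σ (Fin m) λ i → Σ (Fin n) λ j → Fin (f i j)
  sum-sum-↔ f = mk↔ₛ′
      (λ (i , x) → i , to (sum-↔ (f i)) x)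
      (λ (i , x) → i , from (sum-↔ (f i)) x)
      (λ (i , x) → ≡.cong (i ,_) (strictlyInverseˡ (sum-↔ (f i)) x))
      (λ (i , x) → ≡.cong (i ,_) (strictlyInverseʳ (sum-↔ (f i)) x))
    ↔-∘ sum-↔ (λ i → sum (f i))
    where open Inverse

open Counting

-- Solving ring equations with integer coefficients

-- Over an abstract commutative ring the coefficients of a polynomial identity
-- cannot be compared, so that x - x would not simplify to 0; taking the
-- coefficients from ℤ makes them comparable.
module IntegerSolver {c ℓ} (R : CommutativeRing c ℓ) where

  open CommutativeRing R hiding (zero)
  open import Algebra.Properties.Ring ring
  open import Algebra.Properties.AbelianGroup +-abelianGroup using (⁻¹-∙-comm)
  open import Algebra.Properties.Semiring.Mult.TCOptimised semiring
    using (×-homo-+; ×1-homo-*) renaming (_×_ to _·_)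
  open import Algebra.Solver.Ring.AlmostCommutativeRing
  open SetoidReasoning setoid

  private
    -- The homomorphism from ℤ to R.
    ⟦_⟧ℤ : ℤ → Carrier
    ⟦ + n ⟧ℤ      = n · 1#
    ⟦ -[1+ n ] ⟧ℤ = - (suc n · 1#)

    ⊖-homo : ∀ m n → ⟦ m ⊖ n ⟧ℤ ≈ m · 1# - n · 1#
    ⊖-homo m zero = sym (trans (+-congˡ -0#≈0#) (+-identityʳ _))
    ⊖-homo zero (suc n) = sym (+-identityˡ _)
    ⊖-homo (suc m) (suc n) = begin
      ⟦ suc m ⊖ suc n ⟧ℤ                  ≡⟨ ≡.cong ⟦_⟧ℤ (ℤ.[1+m]⊖[1+n]≡m⊖n m n) ⟩
      ⟦ m ⊖ n ⟧ℤ                          ≈⟨ ⊖-homo m n ⟩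
      m · 1# - n · 1#                     ≈⟨ +-congʳ (+-identityʳ _) ⟨
      m · 1# + 0# - n · 1#                ≈⟨ +-congʳ (+-congˡ (-‿inverseʳ 1#)) ⟨
      m · 1# + (1# - 1#) - n · 1#         ≈⟨ +-congʳ (+-assoc _ _ _) ⟨
      m · 1# + 1# - 1# - n · 1#           ≈⟨ +-assoc _ _ _ ⟩
      m · 1# + 1# + (- 1# - n · 1#)       ≈⟨ +-cong (+-comm _ _) (⁻¹-∙-comm _ _) ⟩
      1# + m · 1# - (1# + n · 1#)         ≈⟨ +-cong (×-homo-+ 1# 1 m) (-‿cong (×-homo-+ 1# 1 n)) ⟨
      suc m · 1# - suc n · 1#             ∎

    neg-homo : ∀ i → ⟦ ℤ.- i ⟧ℤ ≈ - ⟦ i ⟧ℤ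
    neg-homo (+ zero)   = sym -0#≈0#
    neg-homo (+ suc n)  = refl
    neg-homo -[1+ n ]   = sym (-‿involutive _)

    +-homo : ∀ i j → ⟦ i ℤ.+ j ⟧ℤ ≈ ⟦ i ⟧ℤ + ⟦ j ⟧ℤ
    +-homo (+ m)    (+ n)    = ×-homo-+ 1# m n
    +-homo (+ m)    -[1+ n ] = ⊖-homo m (suc n)
    +-homo -[1+ m ] (+ n)    = trans (⊖-homo n (suc m)) (+-comm _ _)
    +-homo -[1+ m ] -[1+ n ] = begin
      - (suc (suc (m ℕ.+ n)) · 1#)       ≡⟨ ≡.cong (λ k → - (suc k · 1#)) (ℕ.+-suc m n) ⟨
      - ((suc m ℕ.+ suc n) · 1#)         ≈⟨ -‿cong (×-homo-+ 1# (suc m) (suc n)) ⟩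
      - (suc m · 1# + suc n · 1#)        ≈⟨ ⁻¹-∙-comm _ _ ⟨
      - (suc m · 1#) - suc n · 1#        ∎

    *-homo⁺ : ∀ m j → ⟦ + m ℤ.* j ⟧ℤ ≈ m · 1# * ⟦ j ⟧ℤ
    *-homo⁺ m (+ n)    = trans (reflexive (≡.cong ⟦_⟧ℤ (≡.sym (ℤ.pos-* m n)))) (×1-homo-* m n)
    *-homo⁺ m -[1+ n ] = begin
      ⟦ + m ℤ.* -[1+ n ] ⟧ℤ      ≡⟨ ≡.cong ⟦_⟧ℤ (ℤ.neg-distribʳ-* (+ m) (+ suc n)) ⟨
      ⟦ ℤ.- (+ m ℤ.* + suc n) ⟧ℤ ≈⟨ neg-homo (+ m ℤ.* + suc n) ⟩
      - ⟦ + m ℤ.* + suc n ⟧ℤ     ≈⟨ -‿cong (*-homo⁺ m (+ suc n)) ⟩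
      - (m · 1# * (suc n · 1#))  ≈⟨ -‿distribʳ-* _ _ ⟩
      m · 1# * - (suc n · 1#)    ∎

    *-homo : ∀ i j → ⟦ i ℤ.* j ⟧ℤ ≈ ⟦ i ⟧ℤ * ⟦ j ⟧ℤ
    *-homo (+ m)    j = *-homo⁺ m j
    *-homo -[1+ m ] j = begin
      ⟦ -[1+ m ] ℤ.* j ⟧ℤ        ≡⟨ ≡.cong ⟦_⟧ℤ (ℤ.neg-distribˡ-* (+ suc m) j) ⟨
      ⟦ ℤ.- (+ suc m ℤ.* j) ⟧ℤ   ≈⟨ neg-homo (+ suc m ℤ.* j) ⟩
      - ⟦ + suc m ℤ.* j ⟧ℤ       ≈⟨ -‿cong (*-homo⁺ (suc m) j) ⟩
      - (suc m · 1# * ⟦ j ⟧ℤ)    ≈⟨ -‿distribˡ-* _ _ ⟩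
      - (suc m · 1#) * ⟦ j ⟧ℤ    ∎

    homomorphism : ℤ.+-*-rawRing -Raw-AlmostCommutative⟶ fromCommutativeRing R
    homomorphism = record
      { ⟦_⟧ = ⟦_⟧ℤ ; +-homo = +-homo ; *-homo = *-homo ; -‿homo = neg-homo
      ; 0-homo = refl ; 1-homo = refl }

    ≟-homo : ∀ i j → Maybe (⟦ i ⟧ℤ ≈ ⟦ j ⟧ℤ)
    ≟-homo i j with i ℤ.≟ j
    ... | yes ≡.refl = just refl
    ... | no _       = nothing

  open import Algebra.Solver.Ring ℤ.+-*-rawRing (fromCommutativeRing R) homomorphism ≟-homo public
    using (solve; _:=_; _:+_; _:*_; _:-_; :-_; con)

-- The Frobenius endomorphism

prime∤! : ∀ {p} → Prime p → ∀ k → k ℕ.< p → ¬ p ∣ k ℕ.!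
prime∤! pp zero    k<p p∣1 = contradiction (∣.∣1⇒≡1 p∣1)
  λ { ≡.refl → Prime.¬prime[1] pp }
prime∤! pp (suc k) k<p p∣! with euclidsLemma (suc k) (k ℕ.!) pp p∣!
... | inj₁ p∣1+k = ∣.>⇒∤ k<p p∣1+k
... | inj₂ p∣k!  = prime∤! pp k (ℕ.<-trans (ℕ.n<1+n k) k<p) p∣k!

-- p divides p!, which is (p C k) times k! (p - k)!, but divides neither k! nor
-- (p - k)!.
prime∣binomial : ∀ {p} → Prime p → ∀ k .{{_ : NonZero k}} → k ℕ.< p → p ∣ p C k
prime∣binomial {p} pp k k<p
  with euclidsLemma (p C k) (k ℕ.! ℕ.* (p ℕ.∸ k) ℕ.!) pp p∣C*k![p-k]!
  where
  instance
    _ = Prime.prime⇒nonZero pp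
    _ = ℕ._!*_!≢0 k (p ℕ.∸ k)
  p!≡ : (p C k) ℕ.* (k ℕ.! ℕ.* (p ℕ.∸ k) ℕ.!) ≡ p ℕ.!
  p!≡ = ≡.trans (≡.cong (ℕ._* (k ℕ.! ℕ.* (p ℕ.∸ k) ℕ.!)) (nCk≡n!/k![n-k]! (ℕ.<⇒≤ k<p)))
      (ℕ.m/n*n≡m (k![n∸k]!∣n! (ℕ.<⇒≤ k<p)))
  p∣p! : ∀ p .{{_ : NonZero p}} → p ∣ p ℕ.!
  p∣p! (suc p) = ∣.m∣m*n (p ℕ.!)
  p∣C*k![p-k]! : p ∣ (p C k) ℕ.* (k ℕ.! ℕ.* (p ℕ.∸ k) ℕ.!)
  p∣C*k![p-k]! = ≡.subst (p ∣_) (≡.sym p!≡) (p∣p! p)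
... | inj₁ p∣C = p∣C
... | inj₂ p∣k![p-k]! with euclidsLemma (k ℕ.!) _ pp p∣k![p-k]!
...   | inj₁ p∣k!     = contradiction p∣k! (prime∤! pp k k<p)
...   | inj₂ p∣[p-k]! = contradiction p∣[p-k]!
    (prime∤! pp (p ℕ.∸ k) (ℕ.∸-monoʳ-< (ℕ.>-nonZero⁻¹ k) (ℕ.<⇒≤ k<p)))

module Frobenius {c ℓ} (R : CommutativeRing c ℓ) where
  open CommutativeRing R hiding (zero)
  open import Algebra.Properties.Semiring.Exp semiring
  open import Algebra.Properties.Semiring.Mult semiring
    using (×-cong; ×-homo-1; ×-assoc-*; ×-assocˡ; ×-congʳ) renaming (_×_ to _·_)
  open import Algebra.Properties.CommutativeSemiring.Binomial commutativeSemiring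
    using (theorem; binomialTerm)
  open import Algebra.Properties.Semiring.Sum semiring renaming (sum to ∑)
  open SetoidReasoning setoid

  ∣⇒×≈0 : ∀ {p m} → p · 1# ≈ 0# → p ∣ m → ∀ x → m · x ≈ 0#
  ∣⇒×≈0 {p} p≈0 (divides r ≡.refl) x = begin
    (r ℕ.* p) · x    ≈⟨ ×-assocˡ x r p ⟨
    r · (p · x)      ≈⟨ ×-congʳ r (×-congʳ p (*-identityˡ x)) ⟨
    r · (p · (1# * x)) ≈⟨ ×-congʳ r (×-assoc-* p 1# x) ⟨
    r · ((p · 1#) * x) ≈⟨ ×-congʳ r (trans (*-congʳ p≈0) (zeroˡ x)) ⟩
    r · 0#           ≈⟨ sum-replicate r ⟨
    ∑ {r} (λ _ → 0#) ≈⟨ sum-replicate-zero r ⟩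
    0#               ∎

  -- All terms of the binomial expansion but the first and the last vanish.
  freshman : ∀ {p} → Prime p → p · 1# ≈ 0# → ∀ x y → (x + y) ^ p ≈ x ^ p + y ^ p
  freshman {zero} pp _ = contradiction pp Prime.¬prime[0]
  freshman {suc p-1} pp p≈0 x y = begin
    (x + y) ^ p                                  ≈⟨ theorem p x y ⟩
    t zero + ∑ (t ∘ suc)                       ≈⟨ +-congˡ (sum-init-last (t ∘ suc)) ⟩
    t zero + (∑ (t ∘ suc ∘ inject₁) + t (fromℕ p))
      ≈⟨ +-congˡ (+-cong (trans (sum-cong-≋ middle) (sum-replicate-zero p-1))
          (last (fromℕ p) (Fin.toℕ-fromℕ p))) ⟩
    t zero + (0# + x ^ p)                        ≈⟨ +-cong first (+-identityˡ _) ⟩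
    y ^ p + x ^ p                                ≈⟨ +-comm _ _ ⟩
    x ^ p + y ^ p                                ∎
    where
    p = suc p-1
    t : Fin (suc p) → Carrier
    t = binomialTerm x y p
    first : t zero ≈ y ^ p
    first = begin
      (p C 0) · (1# * y ^ p)
        ≈⟨ ×-cong (≡.trans (nCk≡nC[n∸k] {0} {p} ℕ.z≤n) (nCn≡1 p)) (*-identityˡ _) ⟩
      1 · (y ^ p)            ≈⟨ ×-homo-1 _ ⟩
      y ^ p                  ∎
    last : ∀ k → toℕ k ≡ p → t k ≈ x ^ p
    last k k≡p rewrite k≡p = begin
      (p C p) · (x ^ p * y ^ (p ℕ.∸ p)) ≈⟨ ×-cong (nCn≡1 p) (*-congˡ (^-congʳ y (ℕ.n∸n≡0 p))) ⟩
      1 · (x ^ p * 1#)                  ≈⟨ ×-homo-1 _ ⟩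
      x ^ p * 1#                        ≈⟨ *-identityʳ _ ⟩
      x ^ p                             ∎
    middle : ∀ i → t (suc (inject₁ i)) ≈ 0#
    middle i = ∣⇒×≈0 p≈0 (prime∣binomial pp (suc (toℕ (inject₁ i)))
      (ℕ.s≤s (≡.subst (ℕ._< p-1) (≡.sym (Fin.toℕ-inject₁ i)) (Fin.toℕ<n i)))) _

  ^p^k-homo-+ : ∀ {p} → Prime p → p · 1# ≈ 0# → ∀ k x y →
                (x + y) ^ (p ℕ.^ k) ≈ x ^ (p ℕ.^ k) + y ^ (p ℕ.^ k)
  ^p^k-homo-+ pp p≈0 zero x y = trans (*-identityʳ _)
      (sym (+-cong (*-identityʳ x) (*-identityʳ y)))
  ^p^k-homo-+ {p} pp p≈0 (suc k) x y = begin
    (x + y) ^ (p ℕ.* p ℕ.^ k)                    ≈⟨ ^-assocʳ (x + y) p (p ℕ.^ k) ⟨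
    ((x + y) ^ p) ^ (p ℕ.^ k)                    ≈⟨ ^-congˡ (p ℕ.^ k) (freshman pp p≈0 x y) ⟩
    (x ^ p + y ^ p) ^ (p ℕ.^ k)                  ≈⟨ ^p^k-homo-+ pp p≈0 k (x ^ p) (y ^ p) ⟩
    (x ^ p) ^ (p ℕ.^ k) + (y ^ p) ^ (p ℕ.^ k)    ≈⟨ +-cong (^-assocʳ x p _) (^-assocʳ y p _) ⟩
    x ^ (p ℕ.* p ℕ.^ k) + y ^ (p ℕ.* p ℕ.^ k)    ∎

-- Finite fields

module FiniteField {c ℓ₁ ℓ₂ n} (F : GF c ℓ₁ ℓ₂ n) where
  open import Data.Vec.Base as Vec using (Vec; []; _∷_)
  open GF F hiding (zero)
  open IntegerSolver commutativeRing
  open import Algebra.Properties.Ring ring using (-0#≈0#; +-cancelˡ; x∙y⁻¹≈ε⇒x≈y)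
  open import Algebra.Properties.Semiring.Exp semiring
  open import Algebra.Properties.Semiring.Mult semiring
    using (×1-homo-*; ×-homo-1) renaming (_×_ to _·_)
  import Algebra.Properties.Semiring.Sum semiring as ∑
  import Algebra.Properties.CommutativeMonoid.Sum *-commutativeMonoid as ∏
  open Inverse enumeration public using () renaming
    ( to to ix; from to el; to-cong to ix-cong
    ; strictlyInverseˡ to ix-el; strictlyInverseʳ to el-ix )
  open SetoidReasoning setoid

  -- Equality of elements is equality of their positions in the enumeration el,
  -- whose inverse is ix.  It is abstract so that case distinctions on it are not
  -- disturbed by its unfolding.
  infix 4 _≈?_
  abstract
    _≈?_ : ∀ x y → Dec (x ≈ y)
    x ≈? y = map′ (λ eq → trans (sym (el-ix x)) (trans (reflexive (≡.cong el eq)) (el-ix y)))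
        ix-cong (ix x Fin.≟ ix y)

  x-0≈x : ∀ x → x - 0# ≈ x
  x-0≈x x = trans (+-congˡ -0#≈0#) (+-identityʳ x)

  invertible⇒#0 : ∀ {x y} → y * x ≈ 1# → x # 0#
  invertible⇒#0 {x} {y} yx≈1 = invertible⇒#
    (y , trans (*-congˡ (x-0≈x x)) yx≈1 , trans (*-congʳ (x-0≈x x)) (trans (*-comm x y) yx≈1))

  #0⇒≉0 : ∀ {x} → x # 0# → ¬ x ≈ 0#
  #0⇒≉0 x#0 x≈0 = proj₂ (tight _ _) x≈0 x#0

  1≉0 : ¬ 1# ≈ 0#
  1≉0 = #0⇒≉0 (invertible⇒#0 (*-identityˡ 1#))

  -- Apartness from 0 is not assumed to be decidable, so the inverse is found by
  -- exhaustive search; if there is none, tightness gives x ≈ 0.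
  inverse : ∀ {x} → ¬ x ≈ 0# → ∃[ y ] y * x ≈ 1#
  inverse {x} x≉0 with Fin.any? (λ i → el i * x ≈? 1#)
  ... | yes (i , eq) = el i , eq
  ... | no ∄ = contradiction (proj₁ (tight x 0#) λ x#0 → let (y , yx≈1 , _) = #⇒invertible x#0 in
    ∄ (ix y , trans (*-cong (el-ix y) (sym (x-0≈x x))) yx≈1)) x≉0

  ≉0⇒#0 : ∀ {x} → ¬ x ≈ 0# → x # 0#
  ≉0⇒#0 x≉0 = invertible⇒#0 (proj₂ (inverse x≉0))

  *-cancelˡ : ∀ {x y z} → ¬ x ≈ 0# → x * y ≈ x * z → y ≈ z
  *-cancelˡ {x} {y} {z} x≉0 xy≈xz with inverse x≉0
  ... | w , wx≈1 = begin
    y           ≈⟨ *-identityˡ y ⟨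
    1# * y      ≈⟨ *-congʳ wx≈1 ⟨
    w * x * y   ≈⟨ *-assoc w x y ⟩
    w * (x * y) ≈⟨ *-congˡ xy≈xz ⟩
    w * (x * z) ≈⟨ *-assoc w x z ⟨
    w * x * z   ≈⟨ *-congʳ wx≈1 ⟩
    1# * z      ≈⟨ *-identityˡ z ⟩
    z           ∎

  xy≈0⇒y≈0 : ∀ {x y} → ¬ x ≈ 0# → x * y ≈ 0# → y ≈ 0#
  xy≈0⇒y≈0 x≉0 xy≈0 = *-cancelˡ x≉0 (trans xy≈0 (sym (zeroʳ _)))

  *-≉0 : ∀ {x y} → ¬ x ≈ 0# → ¬ y ≈ 0# → ¬ x * y ≈ 0#
  *-≉0 x≉0 y≉0 xy≈0 = y≉0 (xy≈0⇒y≈0 x≉0 xy≈0)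

  ^-≈0 : ∀ {x} m → x ^ m ≈ 0# → x ≈ 0#
  ^-≈0 zero    1≈0 = contradiction 1≈0 1≉0
  ^-≈0 {x} (suc m) eq with x ≈? 0#
  ... | yes x≈0 = x≈0
  ... | no  x≉0 = ^-≈0 m (xy≈0⇒y≈0 x≉0 eq)

  x-y≈0⇒x≈y : ∀ {x y} → x - y ≈ 0# → x ≈ y
  x-y≈0⇒x≈y = x∙y⁻¹≈ε⇒x≈y _ _

  x≈y⇒x-y≈0 : ∀ {x y} → x ≈ y → x - y ≈ 0#
  x≈y⇒x-y≈0 {y = y} x≈y = trans (+-congʳ x≈y) (-‿inverseʳ y)

  ∑-δ : ∀ x (f : Fin n → ℕ) → sum (λ i → [ x ≈? el i ] ℕ.* f i) ≡ f (ix x)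
  ∑-δ x f = ≡.trans (∑ℕ.sum-cong-≗ λ i → ≡.cong (ℕ._* f i) ([]-cong (x ≈? el i) (ix x Fin.≟ i)
      (λ x≈i → ≡.trans (ix-cong x≈i) (ix-el i)) (λ { ≡.refl → sym (el-ix x) })))
    (sum-δ (ix x) f)

  count-≈ : ∀ x → count (λ i → x ≈? el i) ≡ 1
  count-≈ x = ≡.trans (∑ℕ.sum-cong-≗ λ i → ≡.sym (ℕ.*-identityʳ [ x ≈? el i ])) (∑-δ x (λ _ → 1))

  count-fibres : (φ : Carrier → Carrier) → ∑[ i < n ] count (λ j → φ (el j) ≈? el i) ≡ n
  count-fibres φ = ≡.trans (∑ℕ.sum-cong-≗ λ i → count-cong (λ j → φ (el j) ≈? el i)
      (λ j → ix (φ (el j)) Fin.≟ i)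
      (λ eq → ≡.trans (ix-cong eq) (ix-el i)) (λ { ≡.refl → sym (el-ix _) }))
    (sum-fibres (ix ∘ φ ∘ el))

  bijection : (f g : Carrier → Carrier) →
              (∀ {x y} → x ≈ y → f x ≈ f y) → (∀ {x y} → x ≈ y → g x ≈ g y) →
              (∀ x → f (g x) ≈ x) → (∀ x → g (f x) ≈ x) → Permutation′ n
  bijection f g f-cong g-cong fg gf = Perm.permutation (ix ∘ f ∘ el) (ix ∘ g ∘ el)
    (λ i → ≡.trans (ix-cong (trans (f-cong (el-ix _)) (fg _))) (ix-el i))
    (λ i → ≡.trans (ix-cong (trans (g-cong (el-ix _)) (gf _))) (ix-el i))

  -- A vector of length d stands for the monic polynomial of degree d with these
  -- lower coefficients, the constant coefficient first; eval is Horner's scheme.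
  eval : ∀ {d} → Vec Carrier d → Carrier → Carrier
  eval []       x = 1#
  eval (a ∷ as) x = a + x * eval as x

  -- The quotient by X - r, again monic, obtained by synthetic division.
  quotient : ∀ {d} → Vec Carrier (suc d) → Carrier → Vec Carrier d
  quotient (a ∷ [])     r = []
  quotient (a ∷ b ∷ as) r = eval (b ∷ as) r ∷ quotient (b ∷ as) r

  factor : ∀ {d} (as : Vec Carrier (suc d)) r x →
           eval as x ≈ eval as r + (x - r) * eval (quotient as r) x
  factor (a ∷ [])     r x = solve 3 (λ a r x → a :+ x :* con (+ 1)
      := a :+ r :* con (+ 1) :+ (x :- r) :* con (+ 1)) refl a r x
  factor (a ∷ b ∷ as) r x = begin
    a + x * eval (b ∷ as) x       ≈⟨ +-congˡ (*-congˡ (factor (b ∷ as) r x)) ⟩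
    a + x * (e + (x - r) * z)
      ≈⟨ solve 5 (λ a r x e z → a :+ x :* (e :+ (x :- r) :* z)
          := a :+ r :* e :+ (x :- r) :* (e :+ x :* z)) refl a r x e z ⟩
    a + r * e + (x - r) * (e + x * z) ∎
    where e = eval (b ∷ as) r
          z = eval (quotient (b ∷ as) r) x

  roots≤degree : ∀ {d} (as : Vec Carrier d) → count (λ i → eval as (el i) ≈? 0#) ℕ.≤ d
  roots≤degree []           = ℕ.≤-reflexive (sum-zero {n} λ i → []-false (1# ≈? 0#) 1≉0)
  roots≤degree {suc d} as@(_ ∷ _) with Fin.any? (λ i → eval as (el i) ≈? 0#)
  ... | no ∄ =
      ℕ.≤-trans (ℕ.≤-reflexive (sum-zero λ i → []-false (eval as (el i) ≈? 0#)
      (λ eq → ∄ (i , eq)))) ℕ.z≤n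
  ... | yes (i , root) = ℕ.≤-trans
    (count-⊎ (λ j → eval as (el j) ≈? 0#) (λ j → el i ≈? el j) (λ j → eval bs (el j) ≈? 0#) split)
    (ℕ.+-mono-≤ (ℕ.≤-reflexive (count-≈ (el i))) (roots≤degree bs))
    where
    bs = quotient as (el i)
    split : ∀ {j} → eval as (el j) ≈ 0# → el i ≈ el j ⊎ eval bs (el j) ≈ 0#
    split {j} eq with el i ≈? el j
    ... | yes i≈j = inj₁ i≈j
    ... | no  i≉j = inj₂ (xy≈0⇒y≈0 (i≉j ∘ sym ∘ x-y≈0⇒x≈y) (begin
      (el j - el i) * eval bs (el j)                    ≈⟨ +-identityˡ _ ⟨
      0# + (el j - el i) * eval bs (el j)               ≈⟨ +-congʳ root ⟨
      eval as (el i) + (el j - el i) * eval bs (el j)   ≈⟨ factor as (el i) (el j) ⟨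
      eval as (el j)                                    ≈⟨ eq ⟩
      0#                                                ∎))

  -- The translation x ↦ x + 1 permutes the field, hence fixes the sum of all its
  -- elements.
  n·1≈0 : n · 1# ≈ 0#
  n·1≈0 = +-cancelˡ (∑.sum el) _ _ (begin
    ∑.sum el + n · 1#                ≈⟨ +-congˡ (∑.sum-replicate n) ⟨
    ∑.sum el + ∑.sum {n} (λ _ → 1#)      ≈⟨ ∑.∑-distrib-+ el (λ _ → 1#) ⟨
    ∑.sum (λ i → el i + 1#)          ≈⟨ ∑.sum-cong-≋ (λ i → el-ix (el i + 1#)) ⟨
    ∑.sum (λ i → el (π ⟨$⟩ʳ i))      ≈⟨ ∑.sum-permute el π ⟨
    ∑.sum el                         ≈⟨ +-identityʳ _ ⟨
    ∑.sum el + 0#                    ∎)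
    where
    π = bijection (_+ 1#) (_- 1#) +-congʳ +-congʳ
      (λ x → solve 1 (λ x → x :- con (+ 1) :+ con (+ 1) := x) refl x)
      (λ x → solve 1 (λ x → x :+ con (+ 1) :- con (+ 1) := x) refl x)

  ∏≉0 : ∀ {m} (f : Fin m → Carrier) → (∀ i → ¬ f i ≈ 0#) → ¬ ∏.sum f ≈ 0#
  ∏≉0 {zero}  f f≉0 = 1≉0
  ∏≉0 {suc m} f f≉0 = *-≉0 (f≉0 zero) (∏≉0 (f ∘ suc) (f≉0 ∘ suc))

  ^·1≈0⇒·1≈0 : ∀ p m → (p ℕ.^ m) · 1# ≈ 0# → p · 1# ≈ 0#
  ^·1≈0⇒·1≈0 p zero    eq = contradiction (trans (sym (×-homo-1 1#)) eq) 1≉0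
  ^·1≈0⇒·1≈0 p (suc m) eq with p · 1# ≈? 0#
  ... | yes p≈0 = p≈0
  ... | no  p≉0 = ^·1≈0⇒·1≈0 p m (xy≈0⇒y≈0 p≉0 (trans (sym (×1-homo-* p (p ℕ.^ m))) eq))

  -- If π fixes z and acts elsewhere on the values of f as multiplication by a,
  -- then comparing the product of those values before and after π shows that a
  -- raised to their number is 1.
  lagrange : ∀ {m} (z : Fin m) (f : Fin m → Carrier) (π : Permutation′ m) a →
             π ⟨$⟩ʳ z ≡ z → (∀ i → ¬ z ≡ i → ¬ f i ≈ 0#) → (∀ i → f (π ⟨$⟩ʳ i) ≈ a * f i) →
             a ^ m ≈ a
  lagrange {suc m} z f π a πz≡z f≉0 fπ≈af = begin
    a * a ^ m
      ≈⟨ *-congˡ (*-cancelˡ (∏≉0 g λ i → f≉0 _ (Fin.punchInᵢ≢i z i ∘ ≡.sym)) ∏g*a^m≈∏g*1) ⟩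
    a * 1#      ≈⟨ *-identityʳ a ⟩
    a           ∎
    where
    g : Fin m → Carrier
    g = f ∘ punchIn z
    ρ = Perm.remove z π
    gρ≈ag : ∀ i → g (ρ ⟨$⟩ʳ i) ≈ a * g i
    gρ≈ag i = begin
      f (punchIn z (ρ ⟨$⟩ʳ i))              ≡⟨ ≡.cong (λ w → f (punchIn w (ρ ⟨$⟩ʳ i))) πz≡z ⟨
      f (punchIn (π ⟨$⟩ʳ z) (ρ ⟨$⟩ʳ i))     ≡⟨ ≡.cong f (Perm.punchIn-permute π z i) ⟨
      f (π ⟨$⟩ʳ punchIn z i)                ≈⟨ fπ≈af _ ⟩
      a * g i                               ∎
    ∏g*a^m≈∏g*1 : ∏.sum g * a ^ m ≈ ∏.sum g * 1#
    ∏g*a^m≈∏g*1 = begin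
      ∏.sum g * a ^ m                     ≈⟨ *-comm _ _ ⟩
      a ^ m * ∏.sum g                     ≈⟨ *-congʳ (∏.sum-replicate m) ⟨
      ∏.sum {m} (λ _ → a) * ∏.sum g       ≈⟨ ∏.∑-distrib-+ (λ _ → a) g ⟨
      ∏.sum (λ i → a * g i)               ≈⟨ ∏.sum-cong-≋ gρ≈ag ⟨
      ∏.sum (λ i → g (ρ ⟨$⟩ʳ i))          ≈⟨ ∏.sum-permute g ρ ⟨
      ∏.sum g                             ≈⟨ *-identityʳ _ ⟨
      ∏.sum g * 1#                        ∎

  mulBijection : ∀ {a b} → b * a ≈ 1# → Permutation′ n
  mulBijection {a} {b} ba≈1 = bijection (a *_) (b *_) *-congˡ *-congˡ
    (λ x → trans (sym (*-assoc a b x)) (trans (*-congʳ (trans (*-comm a b) ba≈1))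
        (*-identityˡ x)))
    (λ x → trans (sym (*-assoc b a x)) (trans (*-congʳ ba≈1) (*-identityˡ x)))

  fermat : ∀ a → a ^ n ≈ a
  fermat a with a ≈? 0#
  ... | no a≉0 = let (b , ba≈1) = inverse a≉0 in
    lagrange (ix 0#) el (mulBijection ba≈1) a
      (ix-cong (trans (*-congˡ (el-ix 0#)) (zeroʳ a)))
      (λ i z≢i i≈0 → z≢i (≡.trans (ix-cong (sym i≈0)) (ix-el i)))
      (λ i → el-ix _)
  ... | yes a≈0 = begin
    a ^ n   ≈⟨ ^-congˡ n a≈0 ⟩
    0# ^ n  ≈⟨ 0^ (ix 0#) ⟩
    0#      ≈⟨ a≈0 ⟨
    a       ∎
    where
    0^ : ∀ {m} → Fin m → 0# ^ m ≈ 0#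
    0^ {suc m} _ = zeroˡ _

  -- The number of field elements that satisfy a decidable predicate.
  #[_] : ∀ {p} {P : Pred Carrier p} → Decidable P → ℕ
  #[ P? ] = count (P? ∘ el)

  -- If φ has exactly k preimages at each s in T, then it has #[ T ] * k preimages
  -- of T altogether.
  count-preimage : ∀ {p} {T : Pred Carrier p} (T? : Decidable T) → T Respects _≈_ →
    (φ : Carrier → Carrier) (k : ℕ) → (∀ s → T s → #[ (λ y → φ y ≈? s) ] ≡ k) →
    #[ (λ y → T? (φ y)) ] ≡ #[ T? ] ℕ.* k
  count-preimage {T = T} T? resp φ k fibre = ≡R.begin
    ∑[ j < n ] [ T? (φ (el j)) ]
      ≡R.≡⟨ ∑ℕ.sum-cong-≗ (λ j → ≡.trans (∑-δ (φ (el j)) (λ i → [ T? (el i) ]))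
          ([]-cong (T? _) (T? _) (resp (el-ix _)) (resp (sym (el-ix _))))) ⟨
    ∑[ j < n ] (∑[ i < n ] ([ φ (el j) ≈? el i ] ℕ.* [ T? (el i) ]))
      ≡R.≡⟨ ∑ℕ.∑-comm (λ j i → [ φ (el j) ≈? el i ] ℕ.* [ T? (el i) ]) ⟩
    ∑[ i < n ] (∑[ j < n ] ([ φ (el j) ≈? el i ] ℕ.* [ T? (el i) ]))
      ≡R.≡⟨ ∑ℕ.sum-cong-≗
          (λ i → ≡.trans (≡.sym (∑ℕ.*-distribʳ-sum [ T? (el i) ] (λ j → [ φ (el j) ≈? el i ])))
          (fibre′ i)) ⟩
    ∑[ i < n ] ([ T? (el i) ] ℕ.* k)  ≡R.≡⟨ ∑ℕ.*-distribʳ-sum k (λ i → [ T? (el i) ]) ⟨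
    #[ T? ] ℕ.* k  ≡R.∎
    where
    fibre′ : ∀ i → #[ (λ y → φ y ≈? el i) ] ℕ.* [ T? (el i) ] ≡ [ T? (el i) ] ℕ.* k
    fibre′ i with T? (el i)
    ... | yes t = ≡.trans (≡.cong (ℕ._* 1) (fibre (el i) t)) (ℕ.*-comm k 1)
    ... | no _  = ℕ.*-zeroʳ #[ (λ y → φ y ≈? el i) ]

  #-scale : ∀ {p} {P : Pred Carrier p} (P? : Decidable P) → P Respects _≈_ → ∀ {a} → ¬ a ≈ 0# →
            #[ P? ] ≡ #[ (λ y → P? (a * y)) ]
  #-scale P? resp {a} a≉0 = let (b , ba≈1) = inverse a≉0 in
    ≡.trans (∑ℕ.sum-permute (λ i → [ P? (el i) ]) (mulBijection ba≈1))
      (∑ℕ.sum-cong-≗ λ i → []-cong (P? (el (mulBijection ba≈1 ⟨$⟩ʳ i))) (P? (a * el i))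
          (resp (el-ix _)) (resp (sym (el-ix _))))

  #-cong : ∀ {p r} {P : Pred Carrier p} {R : Pred Carrier r}
           (P? : Decidable P) (R? : Decidable R) →
           (∀ {x} → P x → R x) → (∀ {x} → R x → P x) → #[ P? ] ≡ #[ R? ]
  #-cong P? R? f g = count-cong (P? ∘ el) (R? ∘ el) f g

  -- Square roots inside a set S that is closed under negation, in odd
  -- characteristic.  A nonzero x has no square roots in S or exactly two, and
  -- every element of S is a square root of exactly one x.
  module SquareRoots (2≉0 : ¬ 1# + 1# ≈ 0#)
    {p} {S : Pred Carrier p} (S? : Decidable S) (S-resp : S Respects _≈_)
    (S-neg : ∀ {x} → S x → S (- x)) where

    root? : ∀ x → Decidable (λ s → S s × s * s ≈ x)
    root? x s = S? s ×-dec (s * s ≈? x)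

    roots : Carrier → ℕ
    roots x = #[ root? x ]

    ∑-roots : ∑[ i < n ] roots (el i) ≡ #[ S? ]
    ∑-roots = ≡.trans (∑ℕ.∑-comm (λ i j → [ root? (el i) (el j) ])) (∑ℕ.sum-cong-≗ λ j → ≡R.begin
      ∑[ i < n ] [ S? (el j) ×-dec (el j * el j ≈? el i) ]
        ≡R.≡⟨ ∑ℕ.sum-cong-≗ (λ i → []-× (S? (el j)) (el j * el j ≈? el i)) ⟩
      ∑[ i < n ] ([ S? (el j) ] ℕ.* [ el j * el j ≈? el i ])
        ≡R.≡⟨ ∑ℕ.*-distribˡ-sum [ S? (el j) ] (λ i → [ el j * el j ≈? el i ]) ⟨
      [ S? (el j) ] ℕ.* count (λ i → el j * el j ≈? el i)
        ≡R.≡⟨ ≡.cong ([ S? (el j) ] ℕ.*_) (count-≈ _) ⟩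
      [ S? (el j) ] ℕ.* 1  ≡R.≡⟨ ℕ.*-identityʳ _ ⟩
      [ S? (el j) ]  ≡R.∎)

    x²≈0⇒x≈0 : ∀ {s} → s * s ≈ 0# → s ≈ 0#
    x²≈0⇒x≈0 {s} s²≈0 with s ≈? 0#
    ... | yes s≈0 = s≈0
    ... | no  s≉0 = xy≈0⇒y≈0 s≉0 s²≈0

    roots-0 : S 0# → ∀ {x} → 0# ≈ x → roots x ≡ 1
    roots-0 S0 {x} 0≈x = ≡.trans (#-cong (root? x) (0# ≈?_)
      (λ (_ , s²≈x) → sym (x²≈0⇒x≈0 (trans s²≈x (sym 0≈x))))
      (λ 0≈s → S-resp 0≈s S0 , trans (*-congʳ (sym 0≈s)) (trans (zeroˡ _) 0≈x))) (count-≈ 0#)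

    no-roots-0 : ¬ S 0# → ∀ {x} → 0# ≈ x → roots x ≡ 0
    no-roots-0 ¬S0 {x} 0≈x = sum-zero {n} λ i → []-false (root? x (el i))
      λ (Ss , s²≈x) → ¬S0 (S-resp (x²≈0⇒x≈0 (trans s²≈x (sym 0≈x))) Ss)

    -- The number of roots is 0 or 2, written as twice the indicator of its being 2
    -- so that it can be summed over x.
    roots-≉0 : ∀ {x} → ¬ 0# ≈ x → roots x ≡ 2 ℕ.* [ roots x ℕ.≟ 2 ]
    roots-≉0 {x} 0≉x with Fin.any? (root? x ∘ el)
    ... | no ∄ = ≡.trans none (≡.cong (2 ℕ.*_)
        (≡.sym ([]-false (roots x ℕ.≟ 2) λ two → ℕ.0≢1+n (≡.trans (≡.sym none) two))))
      where
      none : roots x ≡ 0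
      none = sum-zero {n} λ i → []-false (root? x (el i)) λ s → ∄ (i , s)
    ... | yes (i , Ss , s²≈x) = ≡.trans both
        (≡.cong (2 ℕ.*_) (≡.sym ([]-true (roots x ℕ.≟ 2) both)))
      where
      s = el i
      -s≉s : ¬ - s ≈ s
      -s≉s -s≈s = *-≉0 2≉0 (λ s≈0 → 0≉x (trans (sym (trans (*-congʳ s≈0) (zeroˡ s))) s²≈x)) (begin
        (1# + 1#) * s   ≈⟨ solve 1 (λ s → (con (+ 1) :+ con (+ 1)) :* s := s :+ s) refl s ⟩
        s + s           ≈⟨ +-congˡ -s≈s ⟨
        s - s           ≈⟨ -‿inverseʳ s ⟩
        0#              ∎)
      onlyRoots : ∀ {t} → t * t ≈ x → s ≈ t ⊎ - s ≈ t
      onlyRoots {t} t²≈x with s ≈? t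
      ... | yes s≈t = inj₁ s≈t
      ... | no  s≉t = inj₂ (sym (x-y≈0⇒x≈y (xy≈0⇒y≈0 (s≉t ∘ sym ∘ x-y≈0⇒x≈y) (begin
        (t - s) * (t - - s)
          ≈⟨ solve 2 (λ s t → (t :- s) :* (t :- (:- s)) := t :* t :- s :* s) refl s t ⟩
        t * t - s * s        ≈⟨ x≈y⇒x-y≈0 (trans t²≈x (sym s²≈x)) ⟩
        0#                   ∎))))
      splits : ∀ j → [ root? x (el j) ] ≡ [ s ≈? el j ] ℕ.+ [ - s ≈? el j ]
      splits j with s ≈? el j | - s ≈? el j
      ... | yes s≈t | yes -s≈t = contradiction (trans -s≈t (sym s≈t)) -s≉s
      ... | yes s≈t | no  _    = []-true (root? x (el j))
          (S-resp s≈t Ss , trans (sym (*-cong s≈t s≈t)) s²≈x)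
      ... | no  _   | yes -s≈t = []-true (root? x (el j)) (S-resp -s≈t (S-neg Ss) ,
        trans (sym (*-cong -s≈t -s≈t)) (trans (solve 1 (λ s → (:- s) :* (:- s) := s :* s)
            refl s) s²≈x))
      ... | no s≉t  | no -s≉t  = []-false (root? x (el j)) λ (_ , t²≈x) → neither (onlyRoots t²≈x)
        where
        neither : ¬ (s ≈ el j ⊎ - s ≈ el j)
        neither (inj₁ s≈t)  = s≉t s≈t
        neither (inj₂ -s≈t) = -s≉t -s≈t
      both : roots x ≡ 2
      both = ≡.trans (∑ℕ.sum-cong-≗ splits)
          (≡.trans (∑ℕ.∑-distrib-+ (λ j → [ s ≈? el j ]) (λ j → [ - s ≈? el j ]))
        (≡.cong₂ ℕ._+_ (count-≈ s) (count-≈ (- s))))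

-- The field of order q², its conjugation, trace and norm

module QuadraticField {c ℓ₁ ℓ₂ q} (q-pp : PrimePower q) (q-odd : ¬ 2 ∣ q)
    (F : GF c ℓ₁ ℓ₂ (q ℕ.^ 2)) where
  open import Data.Vec.Base as Vec using (Vec; []; _∷_)
  n : ℕ
  n = q ℕ.^ 2

  open GF F hiding (zero)
  open FiniteField F
  open IntegerSolver commutativeRing
  open import Algebra.Properties.Ring ring using (+-inverseˡ-unique)
  open import Algebra.Properties.Semiring.Exp semiring
  open import Algebra.Properties.CommutativeSemiring.Exp commutativeSemiring using (^-distrib-*)
  open import Algebra.Properties.Semiring.Mult semiring using (×-homo-1) renaming (_×_ to _·_)
  open SetoidReasoning setoid

  n≡q*q : n ≡ q ℕ.* q
  n≡q*q = ≡.cong (q ℕ.*_) (ℕ.*-identityʳ q)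

  q·1≈0 : q · 1# ≈ 0#
  q·1≈0 = ^·1≈0⇒·1≈0 q 2 n·1≈0

  -- If 1 + 1 vanished then q · 1 would be 1, since q is odd; but it is 0.
  2≉0 : ¬ 1# + 1# ≈ 0#
  2≉0 2≈0 with q ℕ.% 2 in eq | ℕ.m≡m%n+[m/n]*n q 2 | ℕ.m%n<n q 2
  ... | 0 | _  | _ = q-odd (∣.m%n≡0⇒n∣m q 2 eq)
  ... | 1 | q≡ | _ = 1≉0 (begin
    1#                                    ≈⟨ +-identityʳ 1# ⟨
    1# + 0#
      ≈⟨ +-congˡ (Frobenius.∣⇒×≈0 commutativeRing (trans (+-congˡ (+-identityʳ 1#)) 2≈0)
          (divides (q ℕ./ 2) ≡.refl) 1#) ⟨
    (1 ℕ.+ (q ℕ./ 2) ℕ.* 2) · 1#          ≡⟨ ≡.cong (_· 1#) q≡ ⟨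
    q · 1#                                ≈⟨ q·1≈0 ⟩
    0#                                    ∎)
  ... | suc (suc _) | _ | ℕ.s≤s (ℕ.s≤s ())

  q≡2+ : ∃[ r ] q ≡ 2 ℕ.+ r
  q≡2+ = go q ≡.refl
    where
    go : ∀ m → q ≡ m → ∃[ r ] q ≡ 2 ℕ.+ r
    go 0 q≡0 = contradiction (≡.subst (2 ∣_) (≡.sym q≡0) (2 ∣.∣0)) q-odd
    go 1 q≡1 = contradiction (trans (sym (×-homo-1 1#))
        (trans (reflexive (≡.cong (_· 1#) (≡.sym q≡1))) q·1≈0)) 1≉0
    go (suc (suc r)) eq = r , eq

  instance
    q≢0 : NonZero q
    q≢0 = ≡.subst NonZero (≡.sym (proj₂ q≡2+)) _

  -- Conjugation: the involution x ↦ x^q, whose fixed elements are the subfield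
  -- of order q.
  σ : Carrier → Carrier
  σ x = x ^ q

  σ-cong : ∀ {x y} → x ≈ y → σ x ≈ σ y
  σ-cong = ^-congˡ q

  σ-* : ∀ x y → σ (x * y) ≈ σ x * σ y
  σ-* x y = ^-distrib-* x y q

  σ-+ : ∀ x y → σ (x + y) ≈ σ x + σ y
  σ-+ x y = let (p , k , p-prime , _ , q≡p^k) = q-pp in begin
    (x + y) ^ q                      ≡⟨ ≡.cong ((x + y) ^_) q≡p^k ⟩
    (x + y) ^ (p ℕ.^ k)
      ≈⟨ Frobenius.^p^k-homo-+ commutativeRing p-prime (^·1≈0⇒·1≈0 p k
           (trans (reflexive (≡.cong (_· 1#) (≡.sym q≡p^k))) q·1≈0)) k x y ⟩
    x ^ (p ℕ.^ k) + y ^ (p ℕ.^ k)    ≡⟨ ≡.cong (λ m → x ^ m + y ^ m) q≡p^k ⟨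
    x ^ q + y ^ q                    ∎

  -- Every element satisfies x^(q²) = x.
  σ-σ : ∀ x → σ (σ x) ≈ x
  σ-σ x = trans (^-assocʳ x q q) (trans (^-congʳ x (≡.sym n≡q*q)) (fermat x))

  σ-0 : σ 0# ≈ 0#
  σ-0 = trans (^-congʳ 0# (proj₂ q≡2+)) (zeroˡ _)

  σ-1 : σ 1# ≈ 1#
  σ-1 = *-cancelˡ (λ σ1≈0 → 1≉0 (^-≈0 q σ1≈0))
      (trans (sym (σ-* 1# 1#)) (trans (σ-cong (*-identityˡ 1#)) (sym (*-identityʳ (σ 1#)))))

  σ-neg : ∀ x → σ (- x) ≈ - σ x
  σ-neg x = +-inverseˡ-unique (σ (- x)) (σ x)
      (trans (sym (σ-+ (- x) x)) (trans (σ-cong (-‿inverseˡ x)) σ-0))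

  σ-- : ∀ x y → σ (x - y) ≈ σ x - σ y
  σ-- x y = trans (σ-+ x (- y)) (+-congˡ (σ-neg y))

  -- The trace and the norm to the fixed field.
  Tr N : Carrier → Carrier
  Tr x = x + σ x
  N x = x * σ x

  Tr-cong : ∀ {x y} → x ≈ y → Tr x ≈ Tr y
  Tr-cong x≈y = +-cong x≈y (σ-cong x≈y)

  N-cong : ∀ {x y} → x ≈ y → N x ≈ N y
  N-cong x≈y = *-cong x≈y (σ-cong x≈y)

  -- Membership in the fixed field.
  Fixed : Pred Carrier ℓ₁
  Fixed x = σ x ≈ x

  fixed? : Decidable Fixed
  fixed? x = σ x ≈? x

  Fixed-resp : Fixed Respects _≈_
  Fixed-resp x≈y σx≈x = trans (σ-cong (sym x≈y)) (trans σx≈x x≈y)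

  Fixed-neg : ∀ {x} → Fixed x → Fixed (- x)
  Fixed-neg {x} σx≈x = trans (σ-neg x) (-‿cong σx≈x)

  Fixed-* : ∀ {x y} → Fixed x → Fixed y → Fixed (x * y)
  Fixed-* fx fy = trans (σ-* _ _) (*-cong fx fy)

  Fixed-Tr : ∀ x → Fixed (Tr x)
  Fixed-Tr x = trans (σ-+ x (σ x)) (trans (+-congˡ (σ-σ x)) (+-comm _ _))

  Fixed-N : ∀ x → Fixed (N x)
  Fixed-N x = trans (σ-* x (σ x)) (trans (*-congˡ (σ-σ x)) (*-comm _ _))

  eval-0s : ∀ d x → eval (Vec.replicate d 0#) x ≈ x ^ d
  eval-0s zero    x = refl
  eval-0s (suc d) x = trans (+-identityˡ _) (*-congˡ (eval-0s d x))

  -- As q is at least 2, the polynomial X^q + a X + b is monic of degree q.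
  σ-affine-roots : ∀ a b → #[ (λ x → σ x + a * x + b ≈? 0#) ] ℕ.≤ q
  σ-affine-roots a b with q≡2+
  ... | r , ≡.refl =
      ℕ.≤-trans (ℕ.≤-reflexive (#-cong (λ x → σ x + a * x + b ≈? 0#) (λ x → eval as x ≈? 0#)
      (trans (evalAs _)) (trans (sym (evalAs _))))) (roots≤degree as)
    where
    as : Vec Carrier (2 ℕ.+ r)
    as = b ∷ a ∷ Vec.replicate r 0#
    evalAs : ∀ x → eval as x ≈ σ x + a * x + b
    evalAs x = trans (+-congˡ (*-congˡ (+-congˡ (*-congˡ (eval-0s r x)))))
      (solve 4 (λ a b x w → b :+ x :* (a :+ x :* w) := x :* (x :* w) :+ a :* x :+ b)
          refl a b x (x ^ r))

  N-fibre-bound : ∀ s → #[ (λ x → N x ≈? s) ] ℕ.≤ suc q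
  N-fibre-bound s = ℕ.≤-trans (ℕ.≤-reflexive (#-cong (λ x → N x ≈? s) (λ x → eval as x ≈? 0#)
      (λ {x} eq → trans (evalAs x) (x≈y⇒x-y≈0 eq))
          (λ {x} eq → x-y≈0⇒x≈y (trans (sym (evalAs x)) eq)))) (roots≤degree as)
    where
    as : Vec Carrier (suc q)
    as = - s ∷ Vec.replicate q 0#
    evalAs : ∀ x → eval as x ≈ N x - s
    evalAs x = trans (+-congˡ (*-congˡ (eval-0s q x))) (+-comm _ _)

  Tr-fibre-bound : ∀ s → #[ (λ x → Tr x ≈? s) ] ℕ.≤ q
  Tr-fibre-bound s =
      ℕ.≤-trans (ℕ.≤-reflexive (#-cong (λ x → Tr x ≈? s) (λ x → σ x + 1# * x + - s ≈? 0#)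
    (λ {x} eq → trans (lem x) (x≈y⇒x-y≈0 eq)) (λ {x} eq → x-y≈0⇒x≈y (trans (sym (lem x)) eq))))
        (σ-affine-roots 1# (- s))
    where
    lem : ∀ x → σ x + 1# * x + - s ≈ Tr x - s
    lem x = +-congʳ (trans (+-congˡ (*-identityˡ x)) (+-comm _ _))

  fixed-bound : #[ fixed? ] ℕ.≤ q
  fixed-bound = ℕ.≤-trans (ℕ.≤-reflexive (#-cong fixed? (λ x → σ x + - 1# * x + 0# ≈? 0#)
    (λ {x} eq → trans (lem x) (x≈y⇒x-y≈0 eq)) (λ {x} eq → x-y≈0⇒x≈y (trans (sym (lem x)) eq))))
        (σ-affine-roots (- 1#) 0#)
    where
    lem : ∀ x → σ x + - 1# * x + 0# ≈ σ x - x
    lem x = solve 2 (λ x w → w :+ (:- con (+ 1)) :* x :+ con (+ 0) := w :- x) refl x (σ x)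

  private
    -- The traces are fixed, so the q² elements are spread over at most q fibres of
    -- at most q elements each.  Both bounds must therefore be attained.
    Tr-bound : ∀ i → #[ (λ x → Tr x ≈? el i) ] ℕ.≤ [ fixed? (el i) ] ℕ.* q
    Tr-bound i with fixed? (el i)
    ... | yes _ = ℕ.≤-trans (Tr-fibre-bound (el i)) (ℕ.≤-reflexive (≡.sym (ℕ.*-identityˡ q)))
    ... | no ¬f = ℕ.≤-reflexive (sum-zero {n} λ j → []-false (Tr (el j) ≈? el i) λ eq → ¬f
        (Fixed-resp eq (Fixed-Tr (el j))))

    ∑-fixed : ∑[ i < n ] ([ fixed? (el i) ] ℕ.* q) ≡ #[ fixed? ] ℕ.* q
    ∑-fixed = ≡.sym (∑ℕ.*-distribʳ-sum q (λ i → [ fixed? (el i) ]))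

    ∑-Tr≡ : ∑[ i < n ] #[ (λ x → Tr x ≈? el i) ] ≡ q ℕ.* q
    ∑-Tr≡ = ≡.trans (count-fibres Tr) n≡q*q

  #fixed≡q : #[ fixed? ] ≡ q
  #fixed≡q = ℕ.≤-antisym fixed-bound (ℕ.*-cancelʳ-≤ q #[ fixed? ] q
    (ℕ.≤-trans (ℕ.≤-reflexive (≡.sym ∑-Tr≡))
        (ℕ.≤-trans (sum-mono Tr-bound) (ℕ.≤-reflexive ∑-fixed))))

  Tr-fibre : ∀ {s} → Fixed s → #[ (λ x → Tr x ≈? s) ] ≡ q
  Tr-fibre {s} fs = ≡.trans (#-cong (λ x → Tr x ≈? s) (λ x → Tr x ≈? el (ix s))
      (λ eq → trans eq (sym (el-ix s))) (λ eq → trans eq (el-ix s)))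
    (≡.trans
        (sum-tight Tr-bound
        (ℕ.≤-reflexive (≡.trans ∑-fixed (≡.trans (≡.cong (ℕ._* q) #fixed≡q) (≡.sym ∑-Tr≡))))
        (ix s))
    (≡.trans (≡.cong (ℕ._* q) ([]-true (fixed? (el (ix s))) (Fixed-resp (sym (el-ix s)) fs)))
        (ℕ.*-identityˡ q)))

  -- The elements of norm 1.
  unit? : Decidable (λ x → N x ≈ 1#)
  unit? x = N x ≈? 1#

  private
    #N⁻¹ : Carrier → ℕ
    #N⁻¹ s = #[ (λ x → N x ≈? s) ]

    m+q*0≡m : ∀ m → m ℕ.+ q ℕ.* 0 ≡ m
    m+q*0≡m m = ≡.trans (≡.cong (m ℕ.+_) (ℕ.*-zeroʳ q)) (ℕ.+-identityʳ m)

    #N⁻¹0 : ∀ {s} → 0# ≈ s → #N⁻¹ s ≡ 1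
    #N⁻¹0 {s} 0≈s = ≡.trans (#-cong (λ x → N x ≈? s) (0# ≈?_)
      (λ Nx≈s → sym (^-≈0 (suc q) (trans Nx≈s (sym 0≈s))))
      (λ 0≈x → trans (*-congʳ (sym 0≈x)) (trans (zeroˡ _) 0≈s))) (count-≈ 0#)

    -- The same argument for the norm: its fibres have at most q + 1 elements, and
    -- only one element has norm 0.  Adding q for the fibre at 0 makes the bound
    -- uniform over the fixed field, and the total q² + q = q (q + 1) again leaves
    -- no slack.
    N-bound : ∀ i → #N⁻¹ (el i) ℕ.+ q ℕ.* [ 0# ≈? el i ] ℕ.≤ [ fixed? (el i) ] ℕ.* suc q
    N-bound i with 0# ≈? el i | fixed? (el i)
    ... | yes 0≈i | no ¬f = contradiction (Fixed-resp 0≈i σ-0) ¬f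
    ... | yes 0≈i | yes _ = ℕ.≤-reflexive (≡.trans
      (≡.cong₂ ℕ._+_ (#N⁻¹0 0≈i) (ℕ.*-identityʳ q)) (≡.sym (ℕ.*-identityˡ (suc q))))
    ... | no _ | yes _ = ℕ.≤-trans (ℕ.≤-reflexive (m+q*0≡m (#N⁻¹ (el i))))
      (ℕ.≤-trans (N-fibre-bound (el i)) (ℕ.≤-reflexive (≡.sym (ℕ.*-identityˡ (suc q)))))
    ... | no _ | no ¬f = ℕ.≤-reflexive (≡.trans (m+q*0≡m (#N⁻¹ (el i)))
      (sum-zero {n} λ j → []-false (N (el j) ≈? el i) λ eq → ¬f (Fixed-resp eq (Fixed-N (el j)))))

    ∑-N≡ : ∑[ i < n ] ([ fixed? (el i) ] ℕ.* suc q) ≡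
           ∑[ i < n ] (#N⁻¹ (el i) ℕ.+ q ℕ.* [ 0# ≈? el i ])
    ∑-N≡ = ≡R.begin
      ∑[ i < n ] ([ fixed? (el i) ] ℕ.* suc q)
        ≡R.≡⟨ ∑ℕ.*-distribʳ-sum (suc q) (λ i → [ fixed? (el i) ]) ⟨
      #[ fixed? ] ℕ.* suc q
        ≡R.≡⟨ ≡.cong (ℕ._* suc q) #fixed≡q ⟩
      q ℕ.* suc q
        ≡R.≡⟨ ≡.trans (ℕ.*-suc q q) (ℕ.+-comm q (q ℕ.* q)) ⟩
      q ℕ.* q ℕ.+ q
        ≡R.≡⟨ ≡.cong₂ ℕ._+_ (≡.trans (count-fibres N) n≡q*q)
            (≡.trans (≡.cong (q ℕ.*_) (count-≈ 0#)) (ℕ.*-identityʳ q)) ⟨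
      ∑[ i < n ] #N⁻¹ (el i) ℕ.+ q ℕ.* #[ 0# ≈?_ ]
        ≡R.≡⟨ ≡.cong (∑[ i < n ] #N⁻¹ (el i) ℕ.+_) (∑ℕ.*-distribˡ-sum q (λ i → [ 0# ≈? el i ])) ⟩
      ∑[ i < n ] #N⁻¹ (el i) ℕ.+ ∑[ i < n ] (q ℕ.* [ 0# ≈? el i ])
        ≡R.≡⟨ ∑ℕ.∑-distrib-+ (#N⁻¹ ∘ el) (λ i → q ℕ.* [ 0# ≈? el i ]) ⟨
      ∑[ i < n ] (#N⁻¹ (el i) ℕ.+ q ℕ.* [ 0# ≈? el i ])  ≡R.∎

  #unit≡1+q : #[ unit? ] ≡ suc q
  #unit≡1+q = ≡R.begin
    #[ unit? ]
      ≡R.≡⟨ #-cong unit? (λ x → N x ≈? 1′) (λ eq → trans eq (sym (el-ix 1#)))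
          (λ eq → trans eq (el-ix 1#)) ⟩
    #N⁻¹ 1′  ≡R.≡⟨ m+q*0≡m (#N⁻¹ 1′) ⟨
    #N⁻¹ 1′ ℕ.+ q ℕ.* 0
      ≡R.≡⟨ ≡.cong (λ k → #N⁻¹ 1′ ℕ.+ q ℕ.* k)
          ([]-false (0# ≈? 1′) λ 0≈1′ → 1≉0 (sym (trans 0≈1′ (el-ix 1#)))) ⟨
    #N⁻¹ 1′ ℕ.+ q ℕ.* [ 0# ≈? 1′ ]  ≡R.≡⟨ sum-tight N-bound (ℕ.≤-reflexive ∑-N≡) (ix 1#) ⟩
    [ fixed? 1′ ] ℕ.* suc q
      ≡R.≡⟨ ≡.cong (ℕ._* suc q) ([]-true (fixed? 1′) (Fixed-resp (sym (el-ix 1#)) σ-1)) ⟩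
    1 ℕ.* suc q  ≡R.≡⟨ ℕ.*-identityˡ (suc q) ⟩
    suc q  ≡R.∎
    where
    1′ = el (ix 1#)

-- Pencil arcs from sets of affine points

module Geometry {c ℓ₁ ℓ₂ n} (F : GF c ℓ₁ ℓ₂ n) where
  open import Data.Vec.Functional using ([]; _∷_)
  open GF F hiding (zero)
  open Π₂ F
  open FiniteField F
  open IntegerSolver commutativeRing
  open import Algebra.Properties.Ring ring using (-0#≈0#; -‿involutive)
  open SetoidReasoning setoid

  ∼-sym : ∀ u v → u ∼ v → v ∼ u
  ∼-sym u v = Setoid.sym homogeneousSetoid {u} {v}

  ∼-trans : ∀ u v w → u ∼ v → v ∼ w → u ∼ w
  ∼-trans u v w = Setoid.trans homogeneousSetoid {u} {v} {w}

  pointsOn-∼ : ∀ l u v → u ∼ v → v ∈ pointsOn l → u ∈ pointsOn l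
  pointsOn-∼ (l , _) (u , _) (v , _) (a , _ , u≈av) on = begin
    l 0F * u 0F + (l 1F * u 1F + (l 2F * u 2F + 0#))
      ≈⟨ +-cong (*-congˡ (u≈av 0F)) (+-cong (*-congˡ (u≈av 1F)) (+-congʳ (*-congˡ (u≈av 2F)))) ⟩
    l 0F * (a * v 0F) + (l 1F * (a * v 1F) + (l 2F * (a * v 2F) + 0#))
      ≈⟨ solve 7 (λ l₀ l₁ l₂ a v₀ v₁ v₂ → l₀ :* (a :* v₀)
          :+ (l₁ :* (a :* v₁) :+ (l₂ :* (a :* v₂) :+ con (+ 0)))
                 := a :* (l₀ :* v₀ :+ (l₁ :* v₁ :+ (l₂ :* v₂ :+ con (+ 0))))) refl
                 (l 0F) (l 1F) (l 2F) a (v 0F) (v 1F) (v 2F) ⟩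
    a * (l 0F * v 0F + (l 1F * v 1F + (l 2F * v 2F + 0#)))
      ≈⟨ trans (*-congˡ on) (zeroʳ a) ⟩
    0# ∎

  dependent⇒≈0 : ∀ x y → ¬ x ∼ y → ∀ a b → (∀ i → a * coords x i + b * coords y i ≈ 0#) → a ≈ 0#
  dependent⇒≈0 (x , k , xk#0) (y , _) x≁y a b eq with a ≈? 0#
  ... | yes a≈0 = a≈0
  ... | no  a≉0 = contradiction (r , ≉0⇒#0 r≉0 , x≈ry) x≁y
    where
    a⁻¹ = proj₁ (inverse a≉0)
    r = - (a⁻¹ * b)
    x≈ry : ∀ i → x i ≈ r * y i
    x≈ry i = begin
      x i                                            ≈⟨ *-identityˡ (x i) ⟨
      1# * x i                                       ≈⟨ *-congʳ (proj₂ (inverse a≉0)) ⟨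
      a⁻¹ * a * x i
        ≈⟨ solve 5 (λ a⁻¹ a b x y → a⁻¹ :* a :* x
            := a⁻¹ :* (a :* x :+ b :* y) :+ (:- (a⁻¹ :* b)) :* y) refl a⁻¹ a b (x i) (y i) ⟩
      a⁻¹ * (a * x i + b * y i) + r * y i
        ≈⟨ +-congʳ (trans (*-congˡ (eq i)) (zeroʳ a⁻¹)) ⟩
      0# + r * y i                                   ≈⟨ +-identityˡ _ ⟩
      r * y i                                        ∎
    r≉0 : ¬ r ≈ 0#
    r≉0 r≈0 = #0⇒≉0 xk#0 (trans (x≈ry k) (trans (*-congʳ r≈0) (zeroˡ _)))

  ≁⇒independent : ∀ x y → ¬ x ∼ y → LinearlyIndependent (coords x ∷ coords y ∷ [])
  ≁⇒independent x y x≁y a eq 0F = dependent⇒≈0 x y x≁y (a 0F) (a 1F)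
    λ i → trans (+-congˡ (sym (+-identityʳ _))) (eq i)
  ≁⇒independent x y x≁y a eq 1F = dependent⇒≈0 y x (x≁y ∘ ∼-sym y x) (a 1F) (a 0F)
    λ i → trans (+-comm _ _) (trans (+-congˡ (sym (+-identityʳ _))) (eq i))

  -- The determinant, expanded along the last coordinate.
  det : V → V → V → Carrier
  det u v w = u 2F * (v 0F * w 1F - w 0F * v 1F)
            + v 2F * (w 0F * u 1F - u 0F * w 1F)
            + w 2F * (u 0F * v 1F - v 0F * u 1F)

  det-rotate : ∀ u v w → det v w u ≈ det u v w
  det-rotate u v w = solve 3 (λ a b c → b :+ c :+ a := a :+ b :+ c) refl _ _ _

  cramer : ∀ u v w a b c → (∀ i → a * u i + (b * v i + c * w i) ≈ 0#) → ¬ det u v w ≈ 0# → a ≈ 0#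
  cramer u v w a b c eq det≉0 = xy≈0⇒y≈0 det≉0 (begin
    det u v w * a
      ≈⟨ solve 12 (λ u₀ u₁ u₂ v₀ v₁ v₂ w₀ w₁ w₂ a b c →
           (u₂ :* (v₀ :* w₁ :- w₀ :* v₁) :+ v₂ :* (w₀ :* u₁ :- u₀ :* w₁)
               :+ w₂ :* (u₀ :* v₁ :- v₀ :* u₁)) :* a
           := (v₁ :* w₂ :- v₂ :* w₁) :* (a :* u₀ :+ (b :* v₀ :+ c :* w₀))
           :+ (v₂ :* w₀ :- v₀ :* w₂) :* (a :* u₁ :+ (b :* v₁ :+ c :* w₁))
           :+ (v₀ :* w₁ :- v₁ :* w₀) :* (a :* u₂ :+ (b :* v₂ :+ c :* w₂))) refl
           (u 0F) (u 1F) (u 2F) (v 0F) (v 1F) (v 2F) (w 0F) (w 1F) (w 2F) a b c ⟩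
    (v 1F * w 2F - v 2F * w 1F) * (a * u 0F + (b * v 0F + c * w 0F))
      + (v 2F * w 0F - v 0F * w 2F) * (a * u 1F + (b * v 1F + c * w 1F))
      + (v 0F * w 1F - v 1F * w 0F) * (a * u 2F + (b * v 2F + c * w 2F))
      ≈⟨ +-cong (+-cong (times0 0F) (times0 1F)) (times0 2F) ⟩
    0# + 0# + 0#
      ≈⟨ trans (+-identityʳ _) (+-identityʳ _) ⟩
    0# ∎)
    where
    times0 : ∀ i {z} → z * (a * u i + (b * v i + c * w i)) ≈ 0#
    times0 i = trans (*-congˡ (eq i)) (zeroʳ _)

  det≉0⇒independent : ∀ u v w → ¬ det u v w ≈ 0# → LinearlyIndependent (u ∷ v ∷ w ∷ [])
  det≉0⇒independent u v w det≉0 a eq = λ where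
      0F → cramer u v w (a 0F) (a 1F) (a 2F) eq′ det≉0
      1F → cramer v w u (a 1F) (a 2F) (a 0F) (λ i → trans (rot _ _ _) (eq′ i))
          (det≉0 ∘ trans (sym (det-rotate u v w)))
      2F → cramer w u v (a 2F) (a 0F) (a 1F) (λ i → trans (sym (rot _ _ _)) (eq′ i))
          (det≉0 ∘ trans (det-rotate w u v))
    where
    rot : ∀ x y z → y + (z + x) ≈ x + (y + z)
    rot = solve 3 (λ x y z → y :+ (z :+ x) := x :+ (y :+ z)) refl
    eq′ : ∀ i → a 0F * u i + (a 1F * v i + a 2F * w i) ≈ 0#
    eq′ i = trans (+-congˡ (+-congˡ (sym (+-identityʳ _)))) (eq i)

  det-∼ : ∀ x y z u v w → x ∼ u → y ∼ v → z ∼ w → ¬ det (coords u) (coords v) (coords w) ≈ 0# →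
          ¬ det (coords x) (coords y) (coords z) ≈ 0#
  det-∼ (x , _) (y , _) (z , _) (u , _) (v , _) (w , _) (a , a#0 , x≈au) (b , b#0 , y≈bv)
      (c , c#0 , z≈cw) det≉0 det≈0 =
    *-≉0 (*-≉0 (*-≉0 (#0⇒≉0 a#0) (#0⇒≉0 b#0)) (#0⇒≉0 c#0)) det≉0 (trans (sym det≈) det≈0)
    where
    minor : ∀ {x₀ x₁ y₀ y₁ u₀ u₁ v₀ v₁} → x₀ ≈ u₀ → x₁ ≈ u₁ → y₀ ≈ v₀ → y₁ ≈ v₁ →
            x₀ * y₁ - y₀ * x₁ ≈ u₀ * v₁ - v₀ * u₁
    minor p q r s = +-cong (*-cong p s) (-‿cong (*-cong r q))
    det≈ : det x y z ≈ a * b * c * det u v w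
    det≈ = begin
      det x y z
        ≈⟨ +-cong (+-cong (*-cong (x≈au 2F) (minor (y≈bv 0F) (y≈bv 1F) (z≈cw 0F) (z≈cw 1F)))
                          (*-cong (y≈bv 2F) (minor (z≈cw 0F) (z≈cw 1F) (x≈au 0F) (x≈au 1F))))
                          (*-cong (z≈cw 2F) (minor (x≈au 0F) (x≈au 1F) (y≈bv 0F) (y≈bv 1F))) ⟩
      det (λ i → a * u i) (λ i → b * v i) (λ i → c * w i)
        ≈⟨ solve 12 (λ u₀ u₁ u₂ v₀ v₁ v₂ w₀ w₁ w₂ a b c →
             a :* u₂ :* (b :* v₀ :* (c :* w₁) :- c :* w₀ :* (b :* v₁))
             :+ b :* v₂ :* (c :* w₀ :* (a :* u₁) :- a :* u₀ :* (c :* w₁))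
             :+ c :* w₂ :* (a :* u₀ :* (b :* v₁) :- b :* v₀ :* (a :* u₁))
             := a :* b :* c :* (u₂ :* (v₀ :* w₁ :- w₀ :* v₁) :+ v₂ :* (w₀ :* u₁ :- u₀ :* w₁)
                 :+ w₂ :* (u₀ :* v₁ :- v₀ :* u₁))) refl
             (u 0F) (u 1F) (u 2F) (v 0F) (v 1F) (v 2F) (w 0F) (w 1F) (w 2F) a b c ⟩
      a * b * c * det u v w ∎

  -- The lines through (0 : 0 : 1) are indexed by the points (zc i : xc i) of the
  -- projective line, (0 : 1) being index zero and (1 : e) the index after that
  -- of e; so they are Fin (suc n) in number.
  zc xc : Fin (suc n) → Carrier
  zc zero    = 0#
  zc (suc j) = 1#
  xc zero    = 1#
  xc (suc j) = el j

  -- Vanishes exactly when i and j are the same direction.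
  Δ : Fin (suc n) → Fin (suc n) → Carrier
  Δ i j = zc i * xc j - zc j * xc i

  1#0 : 1# # 0#
  1#0 = ≉0⇒#0 1≉0

  -1≉0 : ¬ - 1# ≈ 0#
  -1≉0 -1≈0 = 1≉0 (trans (sym (-‿involutive 1#)) (trans (-‿cong -1≈0) -0#≈0#))

  -- The points other than the vertex (0 : 0 : 1), each in exactly one way.
  point : Fin (suc n) → Carrier → Point
  point i y = (zc i ∷ xc i ∷ y ∷ []) , nonzero i
    where
    nonzero : ∀ i → ∃[ k ] (zc i ∷ xc i ∷ y ∷ []) k # 0#
    nonzero zero    = 1F , 1#0
    nonzero (suc j) = 0F , 1#0

  -- The line joining (0 : 0 : 1) to the points point i y.
  lineAt : Fin (suc n) → Line
  lineAt i = (xc i ∷ - zc i ∷ 0# ∷ []) , nonzero i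
    where
    nonzero : ∀ i → ∃[ k ] (xc i ∷ - zc i ∷ 0# ∷ []) k # 0#
    nonzero zero    = 0F , 1#0
    nonzero (suc j) = 1F , ≉0⇒#0 -1≉0

  Δ≈0⇒≡ : ∀ i j → Δ i j ≈ 0# → i ≡ j
  Δ≈0⇒≡ zero    zero    _   = ≡.refl
  Δ≈0⇒≡ zero    (suc j) Δ≈0 = contradiction (trans (solve 1 (λ x → :- con (+ 1)
      := con (+ 0) :* x :- con (+ 1) :* con (+ 1)) refl (el j)) Δ≈0) -1≉0
  Δ≈0⇒≡ (suc i) zero    Δ≈0 = contradiction (trans (solve 1 (λ x → con (+ 1)
      := con (+ 1) :* con (+ 1) :- con (+ 0) :* x) refl (el i)) Δ≈0) 1≉0
  Δ≈0⇒≡ (suc i) (suc j) Δ≈0 =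
      ≡.cong suc (≡.trans (≡.sym (ix-el i)) (≡.trans (ix-cong (sym j≈i)) (ix-el j)))
    where
    j≈i : el j ≈ el i
    j≈i = x-y≈0⇒x≈y (trans (sym (+-cong (*-identityˡ _) (-‿cong (*-identityˡ _)))) Δ≈0)

  Δ-self : ∀ i → Δ i i ≈ 0#
  Δ-self i = -‿inverseʳ _

  lineAt-eq : ∀ i j y → xc i * zc j + (- zc i * xc j + (0# * y + 0#)) ≈ Δ j i
  lineAt-eq i j y =
      solve 5 (λ z z′ x x′ y → x :* z′ :+ ((:- z) :* x′ :+ (con (+ 0) :* y :+ con (+ 0)))
      := z′ :* x :- z :* x′)
    refl (zc i) (zc j) (xc i) (xc j) y

  point∈lineAt⇒≡ : ∀ i j y → point j y ∈ pointsOn (lineAt i) → j ≡ i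
  point∈lineAt⇒≡ i j y on = Δ≈0⇒≡ j i (trans (sym (lineAt-eq i j y)) on)

  point∈lineAt : ∀ i y → point i y ∈ pointsOn (lineAt i)
  point∈lineAt i y = trans (lineAt-eq i i y) (Δ-self i)

  -- The pencil of all lines through (0 : 0 : 1).
  pencil : Pencil
  pencil = record
    { vertex     = vertex
    ; line       = lineAt
    ; concurrent = λ i → solve 2 (λ x z →
        x :* con (+ 0) :+ ((:- z) :* con (+ 0) :+ (con (+ 0) :* con (+ 1) :+ con (+ 0)))
            := con (+ 0))
        refl (xc i) (zc i)
    ; distinct   = λ {i} {j} → distinct i j
    ; complete   = complete
    }
    where
    vertex : Point
    vertex = (0# ∷ 0# ∷ 1# ∷ []) , 2F , 1#0

    distinct : ∀ i j → lineAt i ∼ lineAt j → i ≡ j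
    distinct i j (a , _ , eq) = Δ≈0⇒≡ i j (begin
      zc i * xc j - zc j * xc i
        ≈⟨ solve 4 (λ z z′ x x′ → z :* x′ :- z′ :* x := (:- z′) :* x :- (:- z) :* x′)
            refl (zc i) (zc j) (xc i) (xc j) ⟩
      - zc j * xc i - - zc i * xc j
        ≈⟨ +-cong (*-congˡ (eq 0F)) (-‿cong (*-congʳ (eq 1F))) ⟩
      - zc j * (a * xc j) - (a * - zc j) * xc j
        ≈⟨ solve 3 (λ a z′ x′ → (:- z′) :* (a :* x′) :- (a :* (:- z′)) :* x′ := con (+ 0))
            refl a (zc j) (xc j) ⟩
      0#                                             ∎)

    complete : ∀ l → vertex ∈ pointsOn l → ∃[ i ] l ∼ lineAt i
    complete (l , k , lk#0) on = split (l 1F ≈? 0#)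
      where
      l₂≈0 : l 2F ≈ 0#
      l₂≈0 = trans (solve 3 (λ l₀ l₁ l₂ → l₂
          := l₀ :* con (+ 0) :+ (l₁ :* con (+ 0) :+ (l₂ :* con (+ 1) :+ con (+ 0))))
          refl (l 0F) (l 1F) (l 2F)) on
      split : Dec (l 1F ≈ 0#) → ∃[ i ] (l , k , lk#0) ∼ lineAt i
      split (yes l₁≈0) = zero , l 0F , l₀#0 k lk#0 , λ where
          0F → sym (*-identityʳ _)
          1F → trans l₁≈0 (sym (trans (*-congˡ -0#≈0#) (zeroʳ _)))
          2F → trans l₂≈0 (sym (zeroʳ _))
        where
        l₀#0 : ∀ k → l k # 0# → l 0F # 0#
        l₀#0 0F l₀#0 = l₀#0
        l₀#0 1F l₁#0 = contradiction l₁≈0 (#0⇒≉0 l₁#0)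
        l₀#0 2F l₂#0 = contradiction l₂≈0 (#0⇒≉0 l₂#0)
      split (no l₁≉0) = suc (ix e) , - l 1F , ≉0⇒#0
          (l₁≉0 ∘ λ -l₁≈0 → trans (sym (-‿involutive _)) (trans (-‿cong -l₁≈0) -0#≈0#)) , λ where
          0F → begin
            l 0F                       ≈⟨ *-identityˡ _ ⟨
            1# * l 0F                  ≈⟨ *-congʳ (proj₂ (inverse l₁≉0)) ⟨
            l₁⁻¹ * l 1F * l 0F
              ≈⟨ solve 3 (λ r l₁ l₀ → r :* l₁ :* l₀ := (:- l₁) :* (:- (r :* l₀)))
                  refl l₁⁻¹ (l 1F) (l 0F) ⟩
            - l 1F * e                 ≈⟨ *-congˡ (el-ix e) ⟨
            - l 1F * el (ix e)         ∎
          1F → solve 1 (λ l₁ → l₁ := (:- l₁) :* (:- con (+ 1))) refl (l 1F)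
          2F → trans l₂≈0 (sym (zeroʳ _))
        where
        l₁⁻¹ = proj₁ (inverse l₁≉0)
        e = - (l₁⁻¹ * l 0F)

  point-cong : ∀ i {y y′} → y ≈ y′ → point i y ∼ point i y′
  point-cong i y≈y′ = 1# , 1#0 , λ where
    0F → sym (*-identityˡ _)
    1F → sym (*-identityˡ _)
    2F → trans y≈y′ (sym (*-identityˡ _))

  point-injectiveˡ : ∀ i j y y′ → point i y ∼ point j y′ → i ≡ j
  point-injectiveˡ i j y y′ eq =
      ≡.sym (point∈lineAt⇒≡ i j y′ (pointsOn-∼ (lineAt i) (point j y′) (point i y)
      (∼-sym (point i y) (point j y′) eq) (point∈lineAt i y)))

  point-injectiveʳ : ∀ i y y′ → point i y ∼ point i y′ → y ≈ y′
  point-injectiveʳ i y y′ (a , _ , eq) = trans (eq 2F)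
      (trans (*-congʳ (a≈1 i eq)) (*-identityˡ y′))
    where
    a≈1 : ∀ i → (∀ k → coords (point i y) k ≈ a * coords (point i y′) k) → a ≈ 1#
    a≈1 zero    eq = sym (trans (eq 1F) (*-identityʳ a))
    a≈1 (suc _) eq = sym (trans (eq 0F) (*-identityʳ a))

  -- A set of points avoiding the vertex is given by its sections A i on the lines
  -- of the pencil.  It is a pencil arc as soon as no three of its points on three
  -- different lines of the pencil are collinear.  The expression in noncollinear
  -- is the determinant of point i x, point j y and point k z.
  module PointSets {A : Fin (suc n) → Pred Carrier ℓ₁}
    (A? : ∀ i → Decidable (A i)) (A-resp : ∀ i → A i Respects _≈_)
    (noncollinear : ∀ {i j k x y z} → ¬ i ≡ j → ¬ i ≡ k → ¬ j ≡ k → x ∈ A i → y ∈ A j → z ∈ A k →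
                    ¬ x * Δ j k + y * Δ k i + z * Δ i j ≈ 0#) where

    K : PointSet
    K v = ∃[ i ] ∃[ y ] (y ∈ A i × v ∼ point i y)

    -- The number of points on the line with index i.
    h : Fin (suc n) → ℕ
    h i = #[ A? i ]

    -- Two of three distinct points may lie on a common line of the pencil.  If the
    -- third does not, the determinant is the product of the difference of the last
    -- coordinates of these two with a nonzero Δ.
    general : ∀ {i j k x y z} → x ∈ A i → y ∈ A j → z ∈ A k →
      ¬ (point i x ∼ point j y) → ¬ (point i x ∼ point k z) → ¬ (point j y ∼ point k z) →
      ¬ (i ≡ j × i ≡ k) → ¬ x * Δ j k + y * Δ k i + z * Δ i j ≈ 0#
    general {i} {j} {k} {x} {y} {z} Ax Ay Az x≁y x≁z y≁z i≢jk =
        cases (i Fin.≟ j) (i Fin.≟ k) (j Fin.≟ k)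
      where
      cases : Dec (i ≡ j) → Dec (i ≡ k) → Dec (j ≡ k) → ¬ x * Δ j k + y * Δ k i + z * Δ i j ≈ 0#
      cases (yes ≡.refl) (yes i≡k) _ = contradiction (≡.refl , i≡k) i≢jk
      cases (yes ≡.refl) (no i≢k) _ det≈0 = *-≉0 (λ x-y≈0 → x≁y (point-cong i (x-y≈0⇒x≈y x-y≈0)))
          (i≢k ∘ Δ≈0⇒≡ i k)
        (trans (solve 7 (λ x y z a b a′ b′ → (x :- y) :* (a :* b′ :- a′ :* b)
            := x :* (a :* b′ :- a′ :* b) :+ y :* (a′ :* b :- a :* b′) :+ z :* (a :* b :- a :* b))
            refl x y z (zc i) (xc i) (zc k) (xc k)) det≈0)
      cases (no i≢j) (yes ≡.refl) _ det≈0 = *-≉0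
          (λ z-x≈0 → x≁z (point-cong i (sym (x-y≈0⇒x≈y z-x≈0)))) (i≢j ∘ Δ≈0⇒≡ i j)
        (trans (solve 7 (λ x y z a b a′ b′ → (z :- x) :* (a :* b′ :- a′ :* b)
            := x :* (a′ :* b :- a :* b′) :+ y :* (a :* b :- a :* b) :+ z :* (a :* b′ :- a′ :* b))
            refl x y z (zc i) (xc i) (zc j) (xc j)) det≈0)
      cases (no i≢j) (no _) (yes ≡.refl) det≈0 =
          *-≉0 (λ z-y≈0 → y≁z (point-cong j (sym (x-y≈0⇒x≈y z-y≈0)))) (i≢j ∘ Δ≈0⇒≡ i j)
        (trans (solve 7 (λ x y z a b a′ b′ → (z :- y) :* (a :* b′ :- a′ :* b)
            := x :* (a′ :* b′ :- a′ :* b′) :+ y :* (a′ :* b :- a :* b′)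
            :+ z :* (a :* b′ :- a′ :* b)) refl x y z (zc i) (xc i) (zc j) (xc j)) det≈0)
      cases (no i≢j) (no i≢k) (no j≢k) = noncollinear i≢j i≢k j≢k Ax Ay Az

    private
      el≈ : ∀ i {v y} → v ∼ point i y → v ∼ point i (el (ix y))
      el≈ i {v} {y} v∼ = ∼-trans v (point i y) (point i (el (ix y))) v∼
          (point-cong i (sym (el-ix y)))

      el-injective : ∀ i {j j′} → point i (el j) ∼ point i (el j′) → j ≡ j′
      el-injective i {j} {j′} eq = ≡.trans (≡.sym (ix-el j))
          (≡.trans (ix-cong (point-injectiveʳ i _ _ eq)) (ix-el j′))

    onLine : ∀ i {v} → v ∈ K → v ∈ pointsOn (lineAt i) → ∃[ y ] (y ∈ A i × v ∼ point i y)
    onLine i {v} (i′ , y , Ay , v∼) on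
      with point∈lineAt⇒≡ i i′ y (pointsOn-∼ (lineAt i) (point i′ y) v (∼-sym v (point i′ y) v∼)
          on)
    ... | ≡.refl = y , Ay , v∼

    size : HasSize homogeneousSetoid K (sum h)
    size = hasSize (sum-sum-↔ (λ i j → [ A? i (el j) ])) (λ (i , j , _) → point i (el j))
      (λ (i , j , x) → i , el j , []-elim (A? i (el j)) x ,
          Setoid.refl homogeneousSetoid {point i (el j)})
      (λ { {i , j , x} {i′ , j′ , x′} → injective i j x i′ j′ x′ })
      (λ { v (i , y , Ay , v∼) → (i , ix y , []-intro (A? i (el (ix y)))
          (A-resp i (sym (el-ix y)) Ay)) , el≈ i {v} v∼ })
      where
      injective : ∀ i j x i′ j′ x′ → point i (el j) ∼ point i′ (el j′) →
          (i , j , x) ≡ (i′ , j′ , x′)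
      injective i j x i′ j′ x′ eq with point-injectiveˡ i i′ (el j) (el j′) eq
      ... | ≡.refl with el-injective i eq
      ...   | ≡.refl = ≡.cong (λ x → i , j , x) ([]-unique (A? i (el j)) x x′)

    lineArc : ∀ i → IsLineArc (h i) (K ∩ pointsOn (lineAt i))
    lineArc i = record
      { size = hasSize (sum-↔ (λ j → [ A? i (el j) ])) (λ (j , _) → point i (el j))
          (λ (j , x) → (i , el j , []-elim (A? i (el j)) x ,
              Setoid.refl homogeneousSetoid {point i (el j)}) , point∈lineAt i (el j))
          (λ { {j , x} {j′ , x′} → injective j x j′ x′ })
          (λ { v (v∈K , on) → let (y , Ay , v∼) = onLine i {v} v∈K on in
               (ix y , []-intro (A? i (el (ix y))) (A-resp i (sym (el-ix y)) Ay)) ,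
                   el≈ i {v} v∼ })
      ; independent = λ {x} {y} _ _ → ≁⇒independent x y
      }
      where
      injective : ∀ j x j′ x′ → point i (el j) ∼ point i (el j′) → (j , x) ≡ (j′ , x′)
      injective j x j′ x′ eq with el-injective i eq
      ... | ≡.refl = ≡.cong (j ,_) ([]-unique (A? i (el j)) x x′)

    isParc : ∀ {k} → sum h ≡ k → IsParc k pencil K
    isParc {k} ∑h≡k = record
      { respects    = λ { {u} {v} u∼v (i , y , Ay , u∼) → i , y , Ay , ∼-trans v u (point i y)
          (∼-sym u v u∼v) u∼ }
      ; size        = ≡.subst (HasSize homogeneousSetoid K) ∑h≡k size
      ; h           = h
      ; lineArc     = lineArc
      ; disjoint    = λ { {i} {j} i≢j v (v∈K , v∈i , v∈j) →
          let (y , _ , v∼) = onLine i {v} v∈K v∈i in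
          i≢j (point∈lineAt⇒≡ j i y (pointsOn-∼ (lineAt j) (point i y) v (∼-sym v (point i y) v∼)
              v∈j)) }
      ; independent = λ { {x} {y} {z} → independent x y z }
      }
      where
      independent : ∀ x y z → x ∈ K → y ∈ K → z ∈ K → ¬ x ∼ y → ¬ x ∼ z → ¬ y ∼ z →
        ¬ (∃[ i ] (x ∈ pointsOn (lineAt i) × y ∈ pointsOn (lineAt i) × z ∈ pointsOn (lineAt i))) →
        LinearlyIndependent (coords x ∷ coords y ∷ coords z ∷ [])
      independent x y z (i , a , Aa , x∼) (j , b , Ab , y∼) (k , c , Ac , z∼) x≁y x≁z y≁z ∄line =
        det≉0⇒independent (coords x) (coords y) (coords z)
          (det-∼ x y z (point i a) (point j b) (point k c) x∼ y∼ z∼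
            (general Aa Ab Ac (x≁y ∘ lift x y (point i a) (point j b) x∼ y∼)
                (x≁z ∘ lift x z (point i a) (point k c) x∼ z∼)
              (y≁z ∘ lift y z (point j b) (point k c) y∼ z∼)
              λ { (≡.refl , ≡.refl) → ∄line (i , on i a x x∼ , on i b y y∼ , on i c z z∼) }))
        where
        lift : ∀ u v u′ v′ → u ∼ u′ → v ∼ v′ → u′ ∼ v′ → u ∼ v
        lift u v u′ v′ u∼ v∼ u′∼v′ = ∼-trans u v′ v (∼-trans u u′ v′ u∼ u′∼v′) (∼-sym v v′ v∼)
        on : ∀ i y v → v ∼ point i y → v ∈ pointsOn (lineAt i)
        on i y v v∼ = pointsOn-∼ (lineAt i) v (point i y) v∼ (point∈lineAt i y)

    linesWith : ∀ r s → count (λ i → h i ℕ.≟ s) ≡ r →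
        HasSize (≡.setoid (Fin (suc n))) (λ i → h i ≡ s) r
    linesWith r s ≡.refl = count-hasSize (λ i → h i ℕ.≟ s)

    isRegularParc : ∀ m s → count (λ i → h i ℕ.≟ s) ≡ m → (∀ i → ¬ h i ≡ s → h i ≡ 0) →
        IsRegularParc m s pencil K
    isRegularParc m s ≡.refl h≢s⇒h≡0 =
      let (π , initial , final) = sortingPermutation (λ i → h i ℕ.≟ s) in record
      { isParc    = isParc ≡.refl
      ; m≤n+1     = count≤n (λ i → h i ℕ.≟ s)
      ; labelling = π
      ; initial   = initial
      ; final     = λ i m≤i → h≢s⇒h≡0 _ (final i m≤i)
      }

-- The three pencil arcs

module Constructions {c₀ ℓ₁ ℓ₂ q} (q-pp : PrimePower q) (q-odd : ¬ 2 ∣ q)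
    (F : GF c₀ ℓ₁ ℓ₂ (q ℕ.^ 2)) where
  open GF F hiding (zero)
  open Π₂ F
  open FiniteField F
  open QuadraticField q-pp q-odd F
  open Geometry F
  open IntegerSolver commutativeRing
  open SetoidReasoning setoid

  [k*q≟m*q] : ∀ k m → [ k ℕ.* q ℕ.≟ m ℕ.* q ] ≡ [ k ℕ.≟ m ]
  [k*q≟m*q] k m = []-cong (k ℕ.* q ℕ.≟ m ℕ.* q) (k ℕ.≟ m) (ℕ.*-cancelʳ-≡ k m q) (≡.cong (ℕ._* q))

  count-multiples : ∀ {h k : Fin (suc n) → ℕ} → (∀ i → h i ≡ k i ℕ.* q) → ∀ m →
                    count (λ i → h i ℕ.≟ m ℕ.* q) ≡ count (λ i → k i ℕ.≟ m)
  count-multiples {h} {k} h≡k*q m = ∑ℕ.sum-cong-≗ λ i →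
    ≡.trans (≡.cong (λ l → [ l ℕ.≟ m ℕ.* q ]) (h≡k*q i)) ([k*q≟m*q] (k i) m)

  -- The conic Z X = T², parametrized by (a² : b² : a b); its point with parameter
  -- (a , b) has to have exactly the coordinates zc i, xc i and s.
  Conic : Fin (suc n) → Carrier → Set _
  Conic i s = ∃[ a ] ∃[ b ] (zc i ≈ a * a × xc i ≈ b * b × s ≈ a * b)

  finite-conic : ∀ j {s} → s * s ≈ el j → Conic (suc j) s
  finite-conic j {s} s²≈x = 1# , s , sym (*-identityˡ 1#) , sym s²≈x , sym (*-identityˡ s)

  -- No three points of the conic are collinear: the determinant is the product
  -- of the three 2 by 2 determinants of the parameters.
  conic-noncollinear : ∀ {i j k s t u} → ¬ i ≡ j → ¬ i ≡ k → ¬ j ≡ k →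
    Conic i s → Conic j t → Conic k u → ¬ s * Δ j k + t * Δ k i + u * Δ i j ≈ 0#
  conic-noncollinear {i} {j} {k} {s} {t} {u} i≢j i≢k j≢k
    (a , b , zi , xi , s≈) (a′ , b′ , zj , xj , t≈) (a″ , b″ , zk , xk , u≈) E≈0 =
    *-≉0 (*-≉0 (d≉0 i≢j zi xi zj xj) (d≉0 j≢k zj xj zk xk)) (d≉0 (i≢k ∘ ≡.sym) zk xk zi xi)
      (trans (sym E≈) E≈0)
    where
    Δ≈ : ∀ {i j a b a′ b′} → zc i ≈ a * a → xc i ≈ b * b → zc j ≈ a′ * a′ → xc j ≈ b′ * b′ →
         Δ i j ≈ a * a * (b′ * b′) - a′ * a′ * (b * b)
    Δ≈ zi xi zj xj = +-cong (*-cong zi xj) (-‿cong (*-cong zj xi))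
    d≉0 : ∀ {i j a b a′ b′} → ¬ i ≡ j → zc i ≈ a * a → xc i ≈ b * b →
          zc j ≈ a′ * a′ → xc j ≈ b′ * b′ → ¬ a * b′ - a′ * b ≈ 0#
    d≉0 {i} {j} {a} {b} {a′} {b′} i≢j zi xi zj xj d≈0 = i≢j (Δ≈0⇒≡ i j (begin
      Δ i j                                        ≈⟨ Δ≈ {i} {j} zi xi zj xj ⟩
      a * a * (b′ * b′) - a′ * a′ * (b * b)
        ≈⟨ solve 4 (λ a b a′ b′ → a :* a :* (b′ :* b′) :- a′ :* a′ :* (b :* b)
            := (a :* b′ :- a′ :* b) :* (a :* b′ :+ a′ :* b)) refl a b a′ b′ ⟩
      (a * b′ - a′ * b) * (a * b′ + a′ * b)        ≈⟨ trans (*-congʳ d≈0) (zeroˡ _) ⟩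
      0#                                           ∎))
    E≈ : s * Δ j k + t * Δ k i + u * Δ i j ≈
         (a * b′ - a′ * b) * (a′ * b″ - a″ * b′) * (a″ * b - a * b″)
    E≈ = trans
      (+-cong (+-cong (*-cong s≈ (Δ≈ {j} {k} zj xj zk xk)) (*-cong t≈ (Δ≈ {k} {i} zk xk zi xi)))
          (*-cong u≈ (Δ≈ {i} {j} zi xi zj xj)))
      (solve 6 (λ a b a′ b′ a″ b″ →
        a :* b :* (a′ :* a′ :* (b″ :* b″) :- a″ :* a″ :* (b′ :* b′))
        :+ a′ :* b′ :* (a″ :* a″ :* (b :* b) :- a :* a :* (b″ :* b″))
        :+ a″ :* b″ :* (a :* a :* (b′ :* b′) :- a′ :* a′ :* (b :* b))
        := (a :* b′ :- a′ :* b) :* (a′ :* b″ :- a″ :* b′) :* (a″ :* b :- a :* b″))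
            refl a b a′ b′ a″ b″)

  -- The direction i is a point over the fixed field.
  FixedDirection : Fin (suc n) → Set _
  FixedDirection i = Fixed (zc i) × Fixed (xc i)

  Fixed-Δ : ∀ i j → FixedDirection i → FixedDirection j → Fixed (Δ i j)
  Fixed-Δ i j (zi , xi) (zj , xj) = trans (σ-- _ _)
      (+-cong (Fixed-* zi xj) (-‿cong (Fixed-* zj xi)))

  σ-combination : ∀ x y z a b c → σ (x * a + y * b + z * c) ≈ σ x * σ a + σ y * σ b + σ z * σ c
  σ-combination x y z a b c = trans (σ-+ _ _)
      (+-cong (trans (σ-+ _ _) (+-cong (σ-* x a) (σ-* y b))) (σ-* z c))

  -- Adding its conjugate to a vanishing determinant replaces the last coordinates
  -- by their traces, if the directions are fixed.
  Tr-det : ∀ {i j k} x y z → FixedDirection i → FixedDirection j → FixedDirection k →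
           x * Δ j k + y * Δ k i + z * Δ i j ≈ 0# →
           Tr x * Δ j k + Tr y * Δ k i + Tr z * Δ i j ≈ 0#
  Tr-det {i} {j} {k} x y z fi fj fk det≈0 = begin
    Tr x * Δ j k + Tr y * Δ k i + Tr z * Δ i j
      ≈⟨ solve 9 (λ x y z x′ y′ z′ a b c → (x :+ x′) :* a :+ (y :+ y′) :* b :+ (z :+ z′) :* c
           := (x :* a :+ y :* b :+ z :* c) :+ (x′ :* a :+ y′ :* b :+ z′ :* c)) refl
           x y z (σ x) (σ y) (σ z) (Δ j k) (Δ k i) (Δ i j) ⟩
    det₀ + (σ x * Δ j k + σ y * Δ k i + σ z * Δ i j)
      ≈⟨ +-congˡ (+-cong (+-cong (*-congˡ (Fixed-Δ j k fj fk)) (*-congˡ (Fixed-Δ k i fk fi)))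
          (*-congˡ (Fixed-Δ i j fi fj))) ⟨
    det₀ + (σ x * σ (Δ j k) + σ y * σ (Δ k i) + σ z * σ (Δ i j))
      ≈⟨ +-congˡ (σ-combination x y z _ _ _) ⟨
    det₀ + σ det₀
      ≈⟨ +-cong det≈0 (trans (σ-cong det≈0) σ-0) ⟩
    0# + 0#
      ≈⟨ +-identityʳ 0# ⟩
    0# ∎
    where det₀ = x * Δ j k + y * Δ k i + z * Δ i j

  -- Square roots in the fixed field.
  module FixedRoots = SquareRoots 2≉0 fixed? Fixed-resp Fixed-neg

  -- The points (z : x : y) with z, x fixed and (Tr y)² = z x.  The equation alone
  -- forces the direction to be fixed, because z is 0 or 1 and traces are fixed.
  module ExternalConic where
    A : Fin (suc n) → Pred Carrier ℓ₁
    A i y = Tr y * Tr y ≈ zc i * xc i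

    A? : ∀ i → Decidable (A i)
    A? i y = Tr y * Tr y ≈? zc i * xc i

    A-resp : ∀ i → A i Respects _≈_
    A-resp i x≈y Ax = trans (sym (*-cong (Tr-cong x≈y) (Tr-cong x≈y))) Ax

    conic : ∀ i {y} → A i y → Conic i (Tr y)
    conic zero    Ay = 0# , 1# , sym (zeroˡ 0#) , sym (*-identityˡ 1#) ,
      trans (FixedRoots.x²≈0⇒x≈0 (trans Ay (zeroˡ 1#))) (sym (zeroˡ 1#))
    conic (suc j) Ay = finite-conic j (trans Ay (*-identityˡ _))

    fixedDirection : ∀ i {y} → A i y → FixedDirection i
    fixedDirection zero    {y} Ay = σ-0 , σ-1
    fixedDirection (suc j) {y} Ay = σ-1 , Fixed-resp (trans Ay (*-identityˡ _))
        (Fixed-* (Fixed-Tr y) (Fixed-Tr y))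

    noncollinear : ∀ {i j k x y z} → ¬ i ≡ j → ¬ i ≡ k → ¬ j ≡ k → x ∈ A i → y ∈ A j → z ∈ A k →
                   ¬ x * Δ j k + y * Δ k i + z * Δ i j ≈ 0#
    noncollinear {i} {j} {k} {x} {y} {z} i≢j i≢k j≢k Ax Ay Az det≈0 =
      conic-noncollinear i≢j i≢k j≢k (conic i Ax) (conic j Ay) (conic k Az)
        (Tr-det {i} {j} {k} x y z (fixedDirection i Ax) (fixedDirection j Ay)
            (fixedDirection k Az) det≈0)

    open PointSets A? A-resp noncollinear public

    -- The number of square roots of x in the fixed field; at infinity, the single
    -- root of the equation (Tr y)² = 0.
    r : Fin (suc n) → ℕ
    r zero    = 1
    r (suc i) = FixedRoots.roots (el i)

    #A≡roots*q : ∀ i x → zc i * xc i ≈ x → h i ≡ FixedRoots.roots x ℕ.* q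
    #A≡roots*q i x zx≈x = ≡.trans
      (#-cong (A? i) (λ y → FixedRoots.root? x (Tr y))
        (λ {y} Ay → Fixed-Tr y , trans Ay zx≈x) (λ (_ , eq) → trans eq (sym zx≈x)))
      (count-preimage (FixedRoots.root? x) (λ s≈t (fs , eq) → Fixed-resp s≈t fs ,
          trans (sym (*-cong s≈t s≈t)) eq)
        Tr q (λ s (fs , _) → Tr-fibre fs))

    h≡r*q : ∀ i → h i ≡ r i ℕ.* q
    h≡r*q zero    = ≡.trans (#A≡roots*q zero 0# (zeroˡ 1#))
        (≡.cong (ℕ._* q) (FixedRoots.roots-0 σ-0 refl))
    h≡r*q (suc i) = #A≡roots*q (suc i) (el i) (*-identityˡ (el i))

    ∑h : sum h ≡ q ℕ.^ 2 ℕ.+ q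
    ∑h = ≡R.begin
      sum h  ≡R.≡⟨ ∑ℕ.sum-cong-≗ h≡r*q ⟩
      sum (λ i → r i ℕ.* q)  ≡R.≡⟨ ∑ℕ.*-distribʳ-sum q r ⟨
      sum r ℕ.* q  ≡R.≡⟨ ≡.cong (λ m → suc m ℕ.* q) (≡.trans FixedRoots.∑-roots #fixed≡q) ⟩
      q ℕ.+ q ℕ.* q  ≡R.≡⟨ ≡.trans (ℕ.+-comm q (q ℕ.* q)) (≡.cong (ℕ._+ q) (≡.sym n≡q*q)) ⟩
      q ℕ.^ 2 ℕ.+ q  ≡R.∎

    private
      r₂ : Fin n → ℕ
      r₂ i = [ FixedRoots.roots (el i) ℕ.≟ 2 ]

      cases : ∀ i → (0# ≈ el i × FixedRoots.roots (el i) ≡ 1) ⊎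
          (¬ 0# ≈ el i × FixedRoots.roots (el i) ≡ 2 ℕ.* r₂ i)
      cases i with 0# ≈? el i
      ... | yes 0≈x = inj₁ (0≈x , FixedRoots.roots-0 σ-0 0≈x)
      ... | no  0≉x = inj₂ (0≉x , FixedRoots.roots-≉0 0≉x)

    r≡1⇔0 : ∀ i → [ FixedRoots.roots (el i) ℕ.≟ 1 ] ≡ [ 0# ≈? el i ]
    r≡1⇔0 i with cases i
    ... | inj₁ (0≈x , r≡1) = ≡.trans ([]-true (_ ℕ.≟ 1) r≡1) (≡.sym ([]-true (0# ≈? el i) 0≈x))
    ... | inj₂ (0≉x , r≡2*) = ≡.trans ([]-false (FixedRoots.roots (el i) ℕ.≟ 1) λ r≡1 → even≢1
        (r₂ i) (≡.trans (≡.sym r≡2*) r≡1))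
                                      (≡.sym ([]-false (0# ≈? el i) 0≉x))
      where
      even≢1 : ∀ m → ¬ 2 ℕ.* m ≡ 1
      even≢1 (suc zero)    ()
      even≢1 (suc (suc m)) ()

    roots≡ : ∀ i → FixedRoots.roots (el i) ≡ [ 0# ≈? el i ] ℕ.+ 2 ℕ.* r₂ i
    roots≡ i with cases i
    ... | inj₁ (0≈x , r≡1) = ≡.trans r≡1
        (≡.sym (≡.cong₂ (λ a b → a ℕ.+ 2 ℕ.* b) ([]-true (0# ≈? el i) 0≈x)
                               ([]-false (FixedRoots.roots (el i) ℕ.≟ 2)
                                   λ r≡2 → contradiction (≡.trans (≡.sym r≡1) r≡2) λ ())))
    ... | inj₂ (0≉x , r≡2*) = ≡.trans r≡2*
        (≡.cong (ℕ._+ 2 ℕ.* r₂ i) (≡.sym ([]-false (0# ≈? el i) 0≉x)))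

    -- The directions with a single root are infinity and 0.
    #h≡q : count (λ i → h i ℕ.≟ q) ≡ 2
    #h≡q = ≡.trans (≡.subst (λ m → count (λ i → h i ℕ.≟ m) ≡ count (λ i → r i ℕ.≟ 1))
        (ℕ.*-identityˡ q) (count-multiples {k = r} h≡r*q 1))
      (≡.cong suc (≡.trans (∑ℕ.sum-cong-≗ r≡1⇔0) (count-≈ 0#)))

    -- The q fixed elements are the roots of all directions other than infinity: one
    -- root of 0, and two of each direction with two roots.
    #h≡2q : count (λ i → h i ℕ.≟ 2 ℕ.* q) ≡ (q ℕ.∸ 1) ℕ./ 2
    #h≡2q = ≡R.begin
      count (λ i → h i ℕ.≟ 2 ℕ.* q)  ≡R.≡⟨ count-multiples {k = r} h≡r*q 2 ⟩
      sum r₂  ≡R.≡⟨ ℕ.m*n/n≡m (sum r₂) 2 ⟨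
      sum r₂ ℕ.* 2 ℕ./ 2  ≡R.≡⟨ ≡.cong (λ m → (m ℕ.∸ 1) ℕ./ 2) q≡1+ ⟨
      (q ℕ.∸ 1) ℕ./ 2  ≡R.∎
      where
      q≡1+ : q ≡ 1 ℕ.+ sum r₂ ℕ.* 2
      q≡1+ = ≡R.begin
        q  ≡R.≡⟨ ≡.trans FixedRoots.∑-roots #fixed≡q ⟨
        sum (λ i → FixedRoots.roots (el i))  ≡R.≡⟨ ∑ℕ.sum-cong-≗ roots≡ ⟩
        sum (λ i → [ 0# ≈? el i ] ℕ.+ 2 ℕ.* r₂ i)
          ≡R.≡⟨ ∑ℕ.∑-distrib-+ (λ i → [ 0# ≈? el i ]) (λ i → 2 ℕ.* r₂ i) ⟩
        #[ 0# ≈?_ ] ℕ.+ sum (λ i → 2 ℕ.* r₂ i)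
          ≡R.≡⟨ ≡.cong₂ ℕ._+_ (count-≈ 0#) (≡.trans (≡.sym (∑ℕ.*-distribˡ-sum 2 r₂))
              (ℕ.*-comm 2 (sum r₂))) ⟩
        1 ℕ.+ sum r₂ ℕ.* 2  ≡R.∎

  Unit-resp : (λ x → N x ≈ 1#) Respects _≈_
  Unit-resp x≈y Nx≈1 = trans (N-cong (sym x≈y)) Nx≈1

  Unit-neg : ∀ {x} → N x ≈ 1# → N (- x) ≈ 1#
  Unit-neg {x} Nx≈1 = trans (*-congˡ (σ-neg x))
      (trans (solve 2 (λ x y → (:- x) :* (:- y) := x :* y) refl x (σ x)) Nx≈1)

  N-* : ∀ x y → N (x * y) ≈ N x * N y
  N-* x y = trans (*-congˡ (σ-* x y)) (solve 4 (λ x y x′ y′ → x :* y :* (x′ :* y′)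
      := x :* x′ :* (y :* y′)) refl x y (σ x) (σ y))

  -- Square roots among the elements of norm 1.
  module UnitRoots = SquareRoots 2≉0 unit? Unit-resp Unit-neg

  -- The points (1 : x : y) such that s = y + x σ y has norm 1 and s² = x.  In the
  -- coordinates (σ s : s : σ s y), which are proportional to these, the last one
  -- has trace 1; so this is the equation (Tr y)² = N u for points (σ u : u : y).
  module InternalConic where
    φ : Carrier → Carrier → Carrier
    φ x y = y + x * σ y

    φ-cong : ∀ x {y y′} → y ≈ y′ → φ x y ≈ φ x y′
    φ-cong x y≈y′ = +-cong y≈y′ (*-congˡ (σ-cong y≈y′))

    A : Fin (suc n) → Pred Carrier ℓ₁
    A zero    y = 1# ≈ 0#
    A (suc i) y = N (φ (el i) y) ≈ 1# × φ (el i) y * φ (el i) y ≈ el i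

    A? : ∀ i → Decidable (A i)
    A? zero    y = 1# ≈? 0#
    A? (suc i) y = UnitRoots.root? (el i) (φ (el i) y)

    root-resp : ∀ x → (λ s → N s ≈ 1# × s * s ≈ x) Respects _≈_
    root-resp x s≈t (Ns≈1 , s²≈x) = Unit-resp s≈t Ns≈1 , trans (sym (*-cong s≈t s≈t)) s²≈x

    A-resp : ∀ i → A i Respects _≈_
    A-resp zero    _   1≈0 = 1≈0
    A-resp (suc i) x≈y = root-resp (el i) (φ-cong (el i) x≈y)

    unitDirection : ∀ i {y} → A (suc i) y → N (el i) ≈ 1#
    unitDirection i (Ns≈1 , s²≈x) = trans (N-cong (sym s²≈x))
        (trans (N-* _ _) (trans (*-cong Ns≈1 Ns≈1) (*-identityˡ 1#)))

    -- For x, y, z of norm 1, the conjugate of z - y is a multiple of y - z.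
    term : ∀ x y z w → N y ≈ 1# → N z ≈ 1# →
        x * w * (1# * z - 1# * y) ≈ - (x * y * z) * (w * (σ z - σ y))
    term x y z w Ny≈1 Nz≈1 = begin
      x * w * (1# * z - 1# * y)    ≈⟨ *-congˡ (+-cong (*-congʳ Ny≈1) (-‿cong (*-congʳ Nz≈1))) ⟨
      x * w * (y * σ y * z - z * σ z * y)
        ≈⟨ solve 6 (λ x y z w y′ z′ → x :* w :* (y :* y′ :* z :- z :* z′ :* y)
            := (:- (x :* y :* z)) :* (w :* (z′ :- y′))) refl x y z w (σ y) (σ z) ⟩
      - (x * y * z) * (w * (σ z - σ y)) ∎

    σ-Δ : ∀ i j → σ (Δ (suc i) (suc j)) ≈ σ (el j) - σ (el i)
    σ-Δ i j = trans (σ-cong (+-cong (*-identityˡ _) (-‿cong (*-identityˡ _)))) (σ-- _ _)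

    noncollinear : ∀ {i j k x y z} → ¬ i ≡ j → ¬ i ≡ k → ¬ j ≡ k → x ∈ A i → y ∈ A j → z ∈ A k →
                   ¬ x * Δ j k + y * Δ k i + z * Δ i j ≈ 0#
    noncollinear {zero}  _ _ _ 1≈0 _ _ _ = 1≉0 1≈0
    noncollinear {suc _} {zero}  _ _ _ _ 1≈0 _ _ = 1≉0 1≈0
    noncollinear {suc _} {suc _} {zero}  _ _ _ _ _ 1≈0 _ = 1≉0 1≈0
    -- The directions u, v, w have norm 1.  Subtracting u v w times its conjugate
    -- from the vanishing determinant replaces x by φ u x, and similarly y and z, so
    -- that three points of the conic become collinear.
    noncollinear {suc i} {suc j} {suc k} {x} {y} {z} i≢j i≢k j≢k Ax Ay Az det≈0 =
      conic-noncollinear i≢j i≢k j≢k (finite-conic i (proj₂ Ax)) (finite-conic j (proj₂ Ay))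
          (finite-conic k (proj₂ Az)) (begin
        φ u x * a + φ v y * b + φ w z * c
          ≈⟨ solve 12 (λ x y z x′ y′ z′ u v w a b c →
              (x :+ u :* x′) :* a :+ (y :+ v :* y′) :* b :+ (z :+ w :* z′) :* c
               := (x :* a :+ y :* b :+ z :* c) :+ (u :* x′ :* a :+ v :* y′ :* b :+ w :* z′ :* c))
                   refl
               x y z (σ x) (σ y) (σ z) u v w a b c ⟩
        det₀ + (u * σ x * a + v * σ y * b + w * σ z * c)
          ≈⟨ +-congˡ (+-cong (+-cong (term u v w (σ x) Nv Nw) (term v w u (σ y) Nw Nu))
              (term w u v (σ z) Nu Nv)) ⟩
        det₀ + (- (u * v * w) * (σ x * (σ w - σ v)) + - (v * w * u) * (σ
            y * (σ u - σ w)) + - (w * u * v) * (σ z * (σ v - σ u)))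
          ≈⟨ +-congˡ
              (solve 9 (λ u v w x y z a b c → (:- (u :* v :* w)) :* (x :* a)
              :+ (:- (v :* w :* u)) :* (y :* b) :+ (:- (w :* u :* v)) :* (z :* c)
               := (:- (u :* v :* w)) :* (x :* a :+ y :* b :+ z :* c))
                   refl u v w (σ x) (σ y) (σ z) (σ w - σ v) (σ u - σ w) (σ v - σ u)) ⟩
        det₀ + - (u * v * w) * (σ x * (σ w - σ v) + σ y * (σ u - σ w) + σ z * (σ v - σ u))
          ≈⟨ +-congˡ
              (*-congˡ (trans (σ-combination x y z a b c)
              (+-cong (+-cong (*-congˡ (σ-Δ j k)) (*-congˡ (σ-Δ k i))) (*-congˡ (σ-Δ i j))))) ⟨
        det₀ + - (u * v * w) * σ det₀
          ≈⟨ +-cong det≈0 (*-congˡ (trans (σ-cong det≈0) σ-0)) ⟩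
        0# + - (u * v * w) * 0#
          ≈⟨ trans (+-identityˡ _) (zeroʳ _) ⟩
        0# ∎)
      where
      u = el i
      v = el j
      w = el k
      a = Δ (suc j) (suc k)
      b = Δ (suc k) (suc i)
      c = Δ (suc i) (suc j)
      det₀ = x * a + y * b + z * c
      Nu = unitDirection i Ax
      Nv = unitDirection j Ay
      Nw = unitDirection k Az

    open PointSets A? A-resp noncollinear public

    r : Fin (suc n) → ℕ
    r zero    = 0
    r (suc i) = UnitRoots.roots (el i)

    -- The substitution y ↦ s y turns the equation φ x y = s into Tr y = 1.
    φ-fibre : ∀ x s → N s ≈ 1# × s * s ≈ x → #[ (λ y → φ x y ≈? s) ] ≡ q
    φ-fibre x s (Ns≈1 , s²≈x) =
        ≡.trans (#-scale (λ y → φ x y ≈? s) (λ y≈y′ eq → trans (sym (φ-cong x y≈y′)) eq) s≉0)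
      (≡.trans (#-cong (λ y → φ x (s * y) ≈? s) (λ y → Tr y ≈? 1#)
        (λ {y} eq → *-cancelˡ s≉0 (trans (sym (φ-s* y)) (trans eq (sym (*-identityʳ s)))))
        (λ {y} eq → trans (φ-s* y) (trans (*-congˡ eq) (*-identityʳ s)))) (Tr-fibre σ-1))
      where
      s≉0 : ¬ s ≈ 0#
      s≉0 s≈0 = 1≉0 (trans (sym Ns≈1) (trans (*-congʳ s≈0) (zeroˡ _)))
      φ-s* : ∀ y → φ x (s * y) ≈ s * Tr y
      φ-s* y = begin
        s * y + x * σ (s * y)            ≈⟨ +-congˡ (*-cong (sym s²≈x) (σ-* s y)) ⟩
        s * y + s * s * (σ s * σ y)
          ≈⟨ solve 4 (λ s y s′ y′ → s :* y :+ s :* s :* (s′ :* y′) := s :* (y :+ s :* s′ :* y′))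
              refl s y (σ s) (σ y) ⟩
        s * (y + s * σ s * σ y)
          ≈⟨ *-congˡ (+-congˡ (trans (*-congʳ Ns≈1) (*-identityˡ _))) ⟩
        s * Tr y                         ∎

    h≡r*q : ∀ i → h i ≡ r i ℕ.* q
    h≡r*q zero    = sum-zero {n} λ j → []-false (1# ≈? 0#) 1≉0
    h≡r*q (suc i) = count-preimage (UnitRoots.root? (el i)) (root-resp (el i)) (φ (el i)) q
        (φ-fibre (el i))

    private
      r₂ : Fin n → ℕ
      r₂ i = [ UnitRoots.roots (el i) ℕ.≟ 2 ]

    roots≡ : ∀ i → UnitRoots.roots (el i) ≡ 2 ℕ.* r₂ i
    roots≡ i with 0# ≈? el i
    ... | no  0≉x = UnitRoots.roots-≉0 0≉x
    ... | yes 0≈x = ≡.trans none (≡.cong (2 ℕ.*_)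
        (≡.sym ([]-false (UnitRoots.roots (el i) ℕ.≟ 2) λ r≡2 → ℕ.0≢1+n
        (≡.trans (≡.sym none) r≡2))))
      where
      none : UnitRoots.roots (el i) ≡ 0
      none = UnitRoots.no-roots-0 (λ N0≈1 → 1≉0 (trans (sym N0≈1) (zeroˡ _))) 0≈x

    #h≡2q : count (λ i → h i ℕ.≟ 2 ℕ.* q) ≡ (q ℕ.+ 1) ℕ./ 2
    #h≡2q = ≡R.begin
      count (λ i → h i ℕ.≟ 2 ℕ.* q)  ≡R.≡⟨ count-multiples {k = r} h≡r*q 2 ⟩
      sum r₂  ≡R.≡⟨ ℕ.m*n/n≡m (sum r₂) 2 ⟨
      sum r₂ ℕ.* 2 ℕ./ 2  ≡R.≡⟨ ≡.cong (ℕ._/ 2) q+1≡ ⟨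
      (q ℕ.+ 1) ℕ./ 2  ≡R.∎
      where
      q+1≡ : q ℕ.+ 1 ≡ sum r₂ ℕ.* 2
      q+1≡ = ≡R.begin
        q ℕ.+ 1  ≡R.≡⟨ ℕ.+-comm q 1 ⟩
        suc q  ≡R.≡⟨ ≡.trans UnitRoots.∑-roots #unit≡1+q ⟨
        sum (λ i → UnitRoots.roots (el i))  ≡R.≡⟨ ∑ℕ.sum-cong-≗ roots≡ ⟩
        sum (λ i → 2 ℕ.* r₂ i)  ≡R.≡⟨ ∑ℕ.*-distribˡ-sum 2 r₂ ⟨
        2 ℕ.* sum r₂  ≡R.≡⟨ ℕ.*-comm 2 (sum r₂) ⟩
        sum r₂ ℕ.* 2  ≡R.∎

    h≢2q⇒h≡0 : ∀ i → ¬ h i ≡ 2 ℕ.* q → h i ≡ 0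
    h≢2q⇒h≡0 i h≢2q = ≡.trans (h≡r*q i)
        (≡.cong (ℕ._* q) (r≡0 i (λ r≡2 → h≢2q (≡.trans (h≡r*q i) (≡.cong (ℕ._* q) r≡2)))))
      where
      r≡0 : ∀ i → ¬ r i ≡ 2 → r i ≡ 0
      r≡0 zero    _   = ≡.refl
      r≡0 (suc i) r≢2 = ≡.trans (roots≡ i)
          (≡.cong (2 ℕ.*_) ([]-false (UnitRoots.roots (el i) ℕ.≟ 2) r≢2))

  -- The points (1 : x : y) with x fixed and Tr y = x².
  module IncidentConic where
    A : Fin (suc n) → Pred Carrier ℓ₁
    A zero    y = 1# ≈ 0#
    A (suc i) y = Fixed (el i) × Tr y ≈ el i * el i

    A? : ∀ i → Decidable (A i)
    A? zero    y = 1# ≈? 0#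
    A? (suc i) y = fixed? (el i) ×-dec (Tr y ≈? el i * el i)

    A-resp : ∀ i → A i Respects _≈_
    A-resp zero    _   1≈0 = 1≈0
    A-resp (suc i) x≈y (fi , eq) = fi , trans (Tr-cong (sym x≈y)) eq

    noncollinear : ∀ {i j k x y z} → ¬ i ≡ j → ¬ i ≡ k → ¬ j ≡ k → x ∈ A i → y ∈ A j → z ∈ A k →
                   ¬ x * Δ j k + y * Δ k i + z * Δ i j ≈ 0#
    noncollinear {zero}  _ _ _ 1≈0 _ _ _ = 1≉0 1≈0
    noncollinear {suc _} {zero}  _ _ _ _ 1≈0 _ _ = 1≉0 1≈0
    noncollinear {suc _} {suc _} {zero}  _ _ _ _ _ 1≈0 _ = 1≉0 1≈0
    noncollinear {suc i} {suc j} {suc k} {x} {y} {z} i≢j i≢k j≢k (fi , x≈) (fj , y≈)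
        (fk , z≈) det≈0 =
      *-≉0 (*-≉0 (i≢j ∘ Δ≈0⇒≡ (suc i) (suc j)) (j≢k ∘ Δ≈0⇒≡ (suc j) (suc k)))
          (i≢k ∘ Δ≈0⇒≡ (suc i) (suc k)) (begin
        Δ (suc i) (suc j) * Δ (suc j) (suc k) * Δ (suc i) (suc k)
          ≈⟨ solve 3 (λ u v w → (con (+ 1) :* v :- con (+ 1) :* u) :* (con (+ 1) :* w :- con
              (+ 1) :* v) :* (con (+ 1) :* w :- con (+ 1) :* u)
               := u :* u :* (con (+ 1) :* w :- con (+ 1) :* v)
                   :+ v :* v :* (con (+ 1) :* u :- con (+ 1) :* w)
                   :+ w :* w :* (con (+ 1) :* v :- con (+ 1) :* u))
               refl (el i) (el j) (el k) ⟩
        el i * el i * Δ (suc j) (suc k) + el j * el j * Δ (suc k) (suc i) + el k * el k * Δ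
            (suc i) (suc j)
          ≈⟨ +-cong (+-cong (*-congʳ x≈) (*-congʳ y≈)) (*-congʳ z≈) ⟨
        Tr x * Δ (suc j) (suc k) + Tr y * Δ (suc k) (suc i) + Tr z * Δ (suc i) (suc j)
          ≈⟨ Tr-det {suc i} {suc j} {suc k} x y z (σ-1 , fi) (σ-1 , fj) (σ-1 , fk) det≈0 ⟩
        0# ∎)

    open PointSets A? A-resp noncollinear public

    r : Fin (suc n) → ℕ
    r zero    = 0
    r (suc i) = [ fixed? (el i) ]

    h≡r*q : ∀ i → h i ≡ r i ℕ.* q
    h≡r*q zero    = sum-zero {n} λ j → []-false (1# ≈? 0#) 1≉0
    h≡r*q (suc i) = ≡.trans (∑ℕ.sum-cong-≗ λ j → []-× (fixed? (el i)) (Tr (el j) ≈? el i * el i))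
      (≡.trans (≡.sym (∑ℕ.*-distribˡ-sum [ fixed? (el i) ] (λ j → [ Tr (el j) ≈? el i * el i ])))
          fibre)
      where
      fibre : [ fixed? (el i) ] ℕ.* #[ (λ y → Tr y ≈? el i * el i) ] ≡ [ fixed? (el i) ] ℕ.* q
      fibre with fixed? (el i)
      ... | yes fi = ≡.cong (1 ℕ.*_) (Tr-fibre (Fixed-* fi fi))
      ... | no _   = ≡.refl

    #h≡q : count (λ i → h i ℕ.≟ q) ≡ q
    #h≡q = ≡.trans (≡.subst (λ m → count (λ i → h i ℕ.≟ m) ≡ count (λ i → r i ℕ.≟ 1))
        (ℕ.*-identityˡ q) (count-multiples {k = r} h≡r*q 1))
      (≡.trans (∑ℕ.sum-cong-≗ λ i → [[d]≟1] (fixed? (el i))) #fixed≡q)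
      where
      [[d]≟1] : ∀ {a} {P : Set a} (d : Dec P) → [ [ d ] ℕ.≟ 1 ] ≡ [ d ]
      [[d]≟1] (yes _) = ≡.refl
      [[d]≟1] (no _)  = ≡.refl

    h≢q⇒h≡0 : ∀ i → ¬ h i ≡ q → h i ≡ 0
    h≢q⇒h≡0 i h≢q = ≡.trans (h≡r*q i)
        (≡.cong (ℕ._* q)
        (r≡0 i
        (λ r≡1 → h≢q (≡.trans (h≡r*q i) (≡.trans (≡.cong (ℕ._* q) r≡1) (ℕ.*-identityˡ q))))))
      where
      r≡0 : ∀ i → ¬ r i ≡ 1 → r i ≡ 0
      r≡0 zero    _   = ≡.refl
      r≡0 (suc i) r≢1 with fixed? (el i)
      ... | yes _ = contradiction ≡.refl r≢1
      ... | no _  = ≡.refl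

open import Data.Nat using (ℕ; _+_; _*_; _∸_; _^_; _/_)

theorem5p2 : ∀ {c ℓ₁ ℓ₂} (q : ℕ) → PrimePower q → ¬ (2 ∣ q) →
    (F : GF c ℓ₁ ℓ₂ (q ^ 2)) →
    let open Π₂ F in
    (∃[ Ψ ] ∃[ K ] Σ[ parc ∈ IsParc (q ^ 2 + q) Ψ K ]
    (IsParc.LinesWith parc 2 q × IsParc.LinesWith parc ((q ∸ 1) / 2) (2 * q)))
    × (∃[ Ψ ] ∃[ K ] IsRegularParc ((q + 1) / 2) (2 * q) Ψ K)
    × (∃[ Ψ ] ∃[ K ] IsRegularParc q q Ψ K)
theorem5p2 q q-pp q-odd F =
    (_ , _ , ExternalConic.isParc ExternalConic.∑h
           , ExternalConic.linesWith 2 q ExternalConic.#h≡q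
           , ExternalConic.linesWith ((q ∸ 1) / 2) (2 * q) ExternalConic.#h≡2q)
  , (_ , _ , InternalConic.isRegularParc ((q + 1) / 2) (2 * q)
               InternalConic.#h≡2q InternalConic.h≢2q⇒h≡0)
  , (_ , _ , IncidentConic.isRegularParc q q IncidentConic.#h≡q IncidentConic.h≢q⇒h≡0)
  where open Constructions q-pp q-odd F
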